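{- Let $d$ be a positive integer and let $Q_d$ denote the $d$-cube. Then $Q_d$ is determined by its distance spectrum: every connected graph whose distance matrix has the same spectrum (eigenvalues with multiplicities) as the distance matrix of $Q_d$ is isomorphic to $Q_d$.
   Context: All graphs are finite, simple and undirected. The $d$-cube $Q_d$ (the Hamming graph $H(d,2)$) has as vertices the $d$-tuples with entries in $\{0,1\}$, two tuples being adjacent iff they differ in exactly one coordinate. For a connected graph $\Gamma$, the distance $d(x,y)$ is the length of a shortest path between $x$ and $y$; the distance matrix $\mathcal{D}(\Gamma)$ is the symmetric matrix indexed by the vertices with $(x,y)$-entry $d(x,y)$. The distance spectrum of $\Gamma$ is the multiset of eigenvalues of $\mathcal{D}(\Gamma)$. Two connected graphs are distance cospectral if their distance spectra coincide; a connected graph $\Gamma$ is determined by its distance spectrum if every connected graph distance cospectral with $\Gamma$ is isomorphic to $\Gamma$. -}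

module Defs where

open import Data.Bool using (Bool; true; false; _xor_; T)
open import Data.Nat using (ℕ; zero; suc; _+_; _≤_; _^_; ⌊_/2⌋; _≡ᵇ_)
open import Relation.Nullary using (yes; no)
open import Data.Fin using (Fin; toℕ; punchIn) renaming (zero to fzero; suc to fsuc)
open import Data.Integer using (ℤ; -_; _-_) renaming (_+_ to _+ℤ_; _*_ to _*ℤ_; +_ to ℤ+_)
open import Data.Product using (Σ; ∃; _×_; _,_)
open import Function.Bundles using (_↔_; Inverse)
open import Relation.Binary.PropositionalEquality using (_≡_; refl; cong; cong₂)

record Graph (n : ℕ) : Set where
  field
    adj     : Fin n → Fin n → Bool
    adj-sym : ∀ x y → adj x y ≡ adj y x
    irrefl  : ∀ x → adj x x ≡ false
open Graph public

data Walk {n : ℕ} (G : Graph n) : Fin n → Fin n → ℕ → Set where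
  here : ∀ {x} → Walk G x x 0
  step : ∀ {x y z k} → T (adj G x y) → Walk G y z k → Walk G x z (suc k)

Connected : ∀ {n} → Graph n → Set
Connected {n} G = ∀ (x y : Fin n) → ∃ λ k → Walk G x y k

IsDistance : ∀ {n} → Graph n → Fin n → Fin n → ℕ → Set
IsDistance G x y k = Walk G x y k × (∀ m → Walk G x y m → k ≤ m)

IsDistanceMatrix : ∀ {n} → Graph n → (Fin n → Fin n → ℕ) → Set
IsDistanceMatrix {n} G D = ∀ (x y : Fin n) → IsDistance G x y (D x y)

Matrix : ℕ → Set
Matrix n = Fin n → Fin n → ℤ

sumFin : ∀ {n} → (Fin n → ℤ) → ℤ
sumFin {zero}  f = ℤ+ 0
sumFin {suc n} f = f fzero +ℤ sumFin (λ i → f (fsuc i))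

signℤ : ℕ → ℤ
signℤ zero    = ℤ+ 1
signℤ (suc k) = - signℤ k

minor : ∀ {n} → Matrix (suc n) → Fin (suc n) → Matrix n
minor M j i k = M (fsuc i) (punchIn j k)

det : ∀ {n} → Matrix n → ℤ
det {zero}  M = ℤ+ 1
det {suc n} M = sumFin (λ j → signℤ (toℕ j) *ℤ M fzero j *ℤ det (minor M j))

charMatrix : ∀ {n} → ℤ → (Fin n → Fin n → ℕ) → Matrix n
charMatrix t D i j with i Data.Fin.≟ j
... | yes _ = t - ℤ+ (D i j)
... | no  _ = - ℤ+ (D i j)

charPolyAt : ∀ {n} → (Fin n → Fin n → ℕ) → ℤ → ℤ
charPolyAt D t = det (charMatrix t D)

-- Two (distance) matrices are cospectral: same characteristic polynomial,
-- i.e. the integer polynomials det(tI − D₁), det(tI − D₂) agree at every t ∈ ℤ.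
Cospectral : ∀ {n m} → (Fin n → Fin n → ℕ) → (Fin m → Fin m → ℕ) → Set
Cospectral D₁ D₂ = ∀ (t : ℤ) → charPolyAt D₁ t ≡ charPolyAt D₂ t

_≅_ : ∀ {n m} → Graph n → Graph m → Set
_≅_ {n} {m} G H = Σ (Fin n ↔ Fin m) λ f →
  ∀ x y → adj G x y ≡ adj H (Inverse.to f x) (Inverse.to f y)

-- The d-cube Q_d on vertex set Fin (2^d): vertex i is identified with
-- the d-tuple of binary digits of toℕ i; adjacency = Hamming distance 1.

parity : ℕ → Bool
parity zero          = false
parity (suc zero)    = true
parity (suc (suc m)) = parity m

bit : ℕ → ℕ → Bool
bit m zero    = parity m
bit m (suc k) = bit ⌊ m /2⌋ k

b2n : Bool → ℕ
b2n true  = 1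
b2n false = 0

hamming : ℕ → ℕ → ℕ → ℕ
hamming zero    a b = 0
hamming (suc d) a b = b2n (bit a d xor bit b d) + hamming d a b

private
  xor-comm : ∀ x y → x xor y ≡ y xor x
  xor-comm true  true  = refl
  xor-comm true  false = refl
  xor-comm false true  = refl
  xor-comm false false = refl

  xor-self : ∀ x → x xor x ≡ false
  xor-self true  = refl
  xor-self false = refl

  hamming-sym : ∀ d a b → hamming d a b ≡ hamming d b a
  hamming-sym zero    a b = refl
  hamming-sym (suc d) a b = cong₂ _+_ (cong b2n (xor-comm (bit a d) (bit b d))) (hamming-sym d a b)

  hamming-self : ∀ d a → hamming d a a ≡ 0
  hamming-self zero    a = refl
  hamming-self (suc d) a rewrite xor-self (bit a d) = hamming-self d a

Cube : (d : ℕ) → Graph (2 ^ d)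
Cube d = record
  { adj     = λ i j → hamming d (toℕ i) (toℕ j) ≡ᵇ 1
  ; adj-sym = λ i j → cong (_≡ᵇ 1) (hamming-sym d (toℕ i) (toℕ j))
  ; irrefl  = λ i → cong (_≡ᵇ 1) (hamming-self d (toℕ i))
  }

{-# OPTIONS --safe #-}
module Submission where

-- Let N = 2^d and let A be the distance matrix of Γ. The distance matrix of Q_d satisfies
-- 4A² + 2NA = d(d+1)N·J. Equal characteristic polynomials give equal traces of powers, so for
-- Γ the matrix M = 4A² + 2NA satisfies (tr M²)² = tr M⁴, hence has rank one. For adjacent x, y the
-- rows of A differ by at most 1 in each entry, which forces M x x = M y y; by connectedness M is
-- constant, and its trace gives M = d(d+1)N·J as well.
--
-- Consequently, with s_xy = A_x − A_y for adjacent x, y, every s_xy is a ±1-vector, and two such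
-- vectors are orthogonal or equal up to sign. A maximal orthogonal family of them embeds Γ
-- isometrically into the cube of dimension the size of the family, and counting row sums shows
-- that this dimension is d.
--
-- Equality of traces: for X = tI − A and p(t) = det X, Cramer's rule yields
-- t·tr(P adj X) = tr(PA adj X) + p(t)·tr P. Here p has exact degree n in t and tr(P adj X) has degree
-- less than n, so if tr(P adj X) agrees for two cospectral matrices, then so do tr P and tr(PA adj X).
-- The induction starts with tr(adj X) = p′(t).

open import Defs
open import Algebra.Properties.CommutativeSemigroup using (interchange)
open import Data.Bool using (Bool; true; false; _xor_; T)
open import Data.Bool.Properties using (xor-comm)
open import Data.Fin using (Fin; zero; suc; toℕ; punchIn; punchOut; splitAt; _↑ˡ_; _↑ʳ_)
import Data.Fin as Fin
import Data.Fin.Properties as Fin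
open import Data.Integer using (ℤ; 0ℤ; 1ℤ; _+_; _*_; -_; _-_; _≤_; ∣_∣) renaming (+_ to ℤ+_; _^_ to _^ℤ_)
import Data.Integer as ℤ
import Data.Integer.Properties as ℤ
open import Data.Integer.Tactic.RingSolver using (solve-∀)
open import Data.List using (List; []; _∷_; length; allFin; cartesianProduct)
open import Data.List.Membership.Propositional.Properties using (∈-allFin; ∈-cartesianProduct⁺)
open import Data.List.Relation.Unary.All as All using (All; []; _∷_)
open import Data.List.Relation.Unary.AllPairs using (AllPairs; []; _∷_)
open import Data.List.Relation.Unary.Any using (Any; here; there)
open import Data.Nat using (ℕ; zero; suc; ⌊_/2⌋; _≡ᵇ_; _^_; _≥_)
import Data.Nat as ℕ
import Data.Nat.Properties as ℕ
open import Data.Product using (∃; _×_; _,_; proj₁; proj₂)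
open import Data.Sum using (_⊎_; inj₁; inj₂)
open import Data.Unit using (tt)
open import Data.Vec using (Vec; []; _∷_)
open import Data.Vec.Functional using (updateAt)
open import Data.Vec.Functional.Properties
  using (updateAt-updates; updateAt-minimal; updateAt-commutes; updateAt-id-local)
open import Function using (const; _∘_)
open import Function.Bundles using (mk↔ₛ′)
open import Relation.Binary using (tri<; tri≈; tri>)
open import Relation.Binary.PropositionalEquality
open import Relation.Nullary using (Dec; yes; no; contradiction)
open import Relation.Nullary.Decidable using (T?)

-- The distance eigenvalues of Q_d lie among d·2^(d-1), 0 and -2^(d-1) = -N/2. The polynomial x(4x +
-- 2N) vanishes at the last two. At the first, whose eigenvector is the all-ones vector, it takes
-- the value d(d+1)N², which spread over J gives the entry d(d+1)N. For Γ the eigenvector of the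
-- rank-one matrix M is unknown at first; the Lipschitz property of distances along edges is what
-- flattens it.
--
-- Cospectrality is given as equality of determinants at integers, so eigenvalues never appear. They
-- are replaced by traces and by vanishing sums of squares in ℤ; factors 2 and 4 clear the halves.
-- Polynomials are treated as functions: degrees become growth bounds, and the equality of n and 2^d
-- is itself a comparison of degrees.
--
-- The rank is tested on tr M² and tr M⁴ because M is not known to be positive semidefinite: for an
-- indefinite symmetric matrix (tr M)² = tr M² does not bound the rank.

private variable
  n m d k l : ℕ
  Item : Set

-- Finite sums and the Kronecker delta

∑-cong : {f g : Fin n → ℤ} → (∀ i → f i ≡ g i) → sumFin f ≡ sumFin g
∑-cong {zero}  eq = refl
∑-cong {suc n} eq = cong₂ _+_ (eq zero) (∑-cong (λ i → eq (suc i)))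

∑-zero : {f : Fin n → ℤ} → (∀ i → f i ≡ 0ℤ) → sumFin f ≡ 0ℤ
∑-zero {zero}  eq = refl
∑-zero {suc n} eq = cong₂ _+_ (eq zero) (∑-zero (λ i → eq (suc i)))

∑-distrib-+ : (f g : Fin n → ℤ) → sumFin (λ i → f i + g i) ≡ sumFin f + sumFin g
∑-distrib-+ {zero}  f g = refl
∑-distrib-+ {suc n} f g =
  trans (cong (f zero + g zero +_) (∑-distrib-+ (f ∘ suc) (g ∘ suc)))
    (lem (f zero) (g zero) (sumFin (f ∘ suc)) (sumFin (g ∘ suc)))
  where
  lem : ∀ a b c d → a + b + (c + d) ≡ a + c + (b + d)
  lem = solve-∀

*-distribˡ-∑ : (c : ℤ) (f : Fin n → ℤ) → sumFin (λ i → c * f i) ≡ c * sumFin f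
*-distribˡ-∑ {zero}  c f = sym (ℤ.*-zeroʳ c)
*-distribˡ-∑ {suc n} c f =
  trans (cong (c * f zero +_) (*-distribˡ-∑ c (f ∘ suc)))
    (sym (ℤ.*-distribˡ-+ c (f zero) (sumFin (f ∘ suc))))

*-distribʳ-∑ : (c : ℤ) (f : Fin n → ℤ) → sumFin (λ i → f i * c) ≡ sumFin f * c
*-distribʳ-∑ c f =
  trans (∑-cong (λ i → ℤ.*-comm (f i) c)) (trans (*-distribˡ-∑ c f) (ℤ.*-comm c (sumFin f)))

∑-linear : (c : ℤ) (f g : Fin n → ℤ) →
           sumFin (λ i → f i + c * g i) ≡ sumFin f + c * sumFin g
∑-linear c f g = trans (∑-distrib-+ f (λ i → c * g i)) (cong (sumFin f +_) (*-distribˡ-∑ c g))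

∑-linear₃ : (c : ℤ) (f g h : Fin n → ℤ) →
            sumFin (λ i → f i + (g i + c * h i)) ≡ sumFin f + (sumFin g + c * sumFin h)
∑-linear₃ c f g h = trans (∑-distrib-+ f (λ i → g i + c * h i)) (cong (sumFin f +_) (∑-linear c g h))

∑-comm : (f : Fin n → Fin m → ℤ) →
         sumFin (λ i → sumFin (λ j → f i j)) ≡ sumFin (λ j → sumFin (λ i → f i j))
∑-comm {zero}  {m} f = sym (∑-zero {m} (λ j → refl))
∑-comm {suc n} {m} f =
  trans (cong (sumFin (f zero) +_) (∑-comm (λ i → f (suc i))))
    (sym (∑-distrib-+ (f zero) (λ j → sumFin (λ i → f (suc i) j))))

∑-const : (c : ℤ) → sumFin {n} (λ _ → c) ≡ ℤ+ n * c
∑-const {zero}  c = sym (ℤ.*-zeroˡ c)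
∑-const {suc n} c = trans (cong (c +_) (∑-const {n} c)) (sym (ℤ.suc-* (ℤ+ n) c))

δ : Fin n → Fin n → ℤ
δ zero    zero    = 1ℤ
δ zero    (suc j) = 0ℤ
δ (suc i) zero    = 0ℤ
δ (suc i) (suc j) = δ i j

∑-δˡ : (i : Fin n) (f : Fin n → ℤ) → sumFin (λ j → δ i j * f j) ≡ f i
∑-δˡ zero    f = trans (cong (1ℤ * f zero +_) (∑-zero (λ i → ℤ.*-zeroˡ (f (suc i)))))
  (trans (ℤ.+-identityʳ (1ℤ * f zero)) (ℤ.*-identityˡ (f zero)))
∑-δˡ (suc i) f = trans (cong₂ _+_ (ℤ.*-zeroˡ (f zero)) (∑-δˡ i (f ∘ suc))) (ℤ.+-identityˡ (f (suc i)))

δ-sym : (i j : Fin n) → δ i j ≡ δ j i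
δ-sym zero    zero    = refl
δ-sym zero    (suc j) = refl
δ-sym (suc i) zero    = refl
δ-sym (suc i) (suc j) = δ-sym i j

δ-refl : (i : Fin n) → δ i i ≡ 1ℤ
δ-refl zero    = refl
δ-refl (suc i) = δ-refl i

δ-≢ : {i j : Fin n} → i ≢ j → δ i j ≡ 0ℤ
δ-≢ {i = zero}  {zero}  i≢j = contradiction refl i≢j
δ-≢ {i = zero}  {suc j} i≢j = refl
δ-≢ {i = suc i} {zero}  i≢j = refl
δ-≢ {i = suc i} {suc j} i≢j = δ-≢ (i≢j ∘ cong suc)

-- Determinants

det-cong : {M M′ : Matrix n} → (∀ i j → M i j ≡ M′ i j) → det M ≡ det M′
det-cong {zero}  eq = refl
det-cong {suc n} eq = ∑-cong λ j →
  cong₂ _*_ (cong (signℤ (toℕ j) *_) (eq zero j)) (det-cong (λ i k → eq (suc i) (punchIn j k)))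

infixl 8 _[_≔_]
_[_≔_] : {A : Set} → (Fin n → A) → Fin n → A → Fin n → A
M [ i ≔ v ] = updateAt M i (const v)

row-≔ : {M : Fin n → Fin m → ℤ} {i : Fin n} {v w : Fin m → ℤ} →
        (∀ k → v k ≡ w k) → ∀ i′ k → (M [ i ≔ v ]) i′ k ≡ (M [ i ≔ w ]) i′ k
row-≔ {i = zero}  eq zero     k = eq k
row-≔ {i = zero}  eq (suc i′) k = refl
row-≔ {i = suc i} eq zero     k = refl
row-≔ {M = M} {i = suc i} eq (suc i′) k = row-≔ {M = M ∘ suc} {i} eq i′ k

minor-≔ : (M : Matrix (suc n)) (i : Fin n) (v : Fin (suc n) → ℤ) (j : Fin (suc n)) →
          ∀ i′ k → minor (M [ suc i ≔ v ]) j i′ k ≡ (minor M j [ i ≔ v ∘ punchIn j ]) i′ k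
minor-≔ {n} M i v j i′ k = go (M ∘ suc) i i′
  where
  go : ∀ {p} (R : Fin p → Fin (suc n) → ℤ) (i i′ : Fin p) →
       (R [ i ≔ v ]) i′ (punchIn j k) ≡ ((λ a b → R a (punchIn j b)) [ i ≔ v ∘ punchIn j ]) i′ k
  go R zero    zero     = refl
  go R zero    (suc i′) = refl
  go R (suc i) zero     = refl
  go R (suc i) (suc i′) = go (R ∘ suc) i i′

det-linear : (M : Matrix n) (i : Fin n) (u v : Fin n → ℤ) (c : ℤ) →
  det (M [ i ≔ (λ k → u k + c * v k) ]) ≡ det (M [ i ≔ u ]) + c * det (M [ i ≔ v ])
det-linear {suc n} M zero u v c =
  trans (∑-cong (λ j → lem (signℤ (toℕ j)) (u j) c (v j) (det (minor M j))))
    (∑-linear c (λ j → signℤ (toℕ j) * u j * det (minor M j)) (λ j → signℤ (toℕ j) * v j * det (minor M j)))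
  where
  lem : ∀ s u c v d → s * (u + c * v) * d ≡ s * u * d + c * (s * v * d)
  lem = solve-∀
det-linear {suc n} M (suc i) u v c =
  trans (∑-cong eachTerm)
    (∑-linear c (λ j → a j * det (minor (M [ suc i ≔ u ]) j)) (λ j → a j * det (minor (M [ suc i ≔ v ]) j)))
  where
  open ≡-Reasoning
  lem : ∀ s d₁ c d₂ → s * (d₁ + c * d₂) ≡ s * d₁ + c * (s * d₂)
  lem = solve-∀
  w : Fin (suc n) → ℤ
  w k = u k + c * v k
  a : Fin (suc n) → ℤ
  a j = signℤ (toℕ j) * M zero j
  minor-det : ∀ v j → det (minor (M [ suc i ≔ v ]) j) ≡ det (minor M j [ i ≔ v ∘ punchIn j ])
  minor-det v j = det-cong (minor-≔ M i v j)
  eachTerm : ∀ j → a j * det (minor (M [ suc i ≔ w ]) j) ≡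
    a j * det (minor (M [ suc i ≔ u ]) j) + c * (a j * det (minor (M [ suc i ≔ v ]) j))
  eachTerm j = begin
    a j * det (minor (M [ suc i ≔ w ]) j)
      ≡⟨ cong (a j *_) (minor-det w j) ⟩
    a j * det (minor M j [ i ≔ w ∘ punchIn j ])
      ≡⟨ cong (a j *_) (det-linear (minor M j) i (u ∘ punchIn j) (v ∘ punchIn j) c) ⟩
    a j * (det (minor M j [ i ≔ u ∘ punchIn j ]) + c * det (minor M j [ i ≔ v ∘ punchIn j ]))
      ≡⟨ cong₂ (λ x y → a j * (x + c * y)) (minor-det u j) (minor-det v j) ⟨
    a j * (det (minor (M [ suc i ≔ u ]) j) + c * det (minor (M [ suc i ≔ v ]) j))
      ≡⟨ lem (a j) (det (minor (M [ suc i ≔ u ]) j)) c (det (minor (M [ suc i ≔ v ]) j)) ⟩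
    a j * det (minor (M [ suc i ≔ u ]) j) + c * (a j * det (minor (M [ suc i ≔ v ]) j)) ∎

det-zeroRow : (M : Matrix n) (i : Fin n) → det (M [ i ≔ (λ _ → 0ℤ) ]) ≡ 0ℤ
det-zeroRow M i = double (trans (det-linear M i (λ _ → 0ℤ) (λ _ → 0ℤ) 1ℤ) (cong (d₀ +_) (ℤ.*-identityˡ d₀)))
  where
  d₀ = det (M [ i ≔ (λ _ → 0ℤ) ])
  x≡x+x-x : ∀ x → x ≡ x + x - x
  x≡x+x-x = solve-∀
  double : ∀ {x} → x ≡ x + x → x ≡ 0ℤ
  double {x} eq = trans (x≡x+x-x x) (trans (cong (_- x) (sym eq)) (ℤ.+-inverseʳ x))

det-∑ : (M : Matrix n) (i : Fin n) (c : Fin m → ℤ) (V : Fin m → Fin n → ℤ) →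
  det (M [ i ≔ (λ k → sumFin (λ j → c j * V j k)) ]) ≡ sumFin (λ j → c j * det (M [ i ≔ V j ]))
det-∑ {m = zero}  M i c V = det-zeroRow M i
det-∑ {m = suc m} M i c V = begin
  det (M [ i ≔ (λ k → c zero * V zero k + rest k) ])
    ≡⟨ det-cong (row-≔ {M = M} {i} (λ k → ℤ.+-comm (c zero * V zero k) (rest k))) ⟩
  det (M [ i ≔ (λ k → rest k + c zero * V zero k) ])
    ≡⟨ det-linear M i rest (V zero) (c zero) ⟩
  det (M [ i ≔ rest ]) + c zero * det (M [ i ≔ V zero ])
    ≡⟨ ℤ.+-comm (det (M [ i ≔ rest ])) (c zero * det (M [ i ≔ V zero ])) ⟩
  c zero * det (M [ i ≔ V zero ]) + det (M [ i ≔ rest ])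
    ≡⟨ cong (c zero * det (M [ i ≔ V zero ]) +_) (det-∑ M i (c ∘ suc) (V ∘ suc)) ⟩
  sumFin (λ j → c j * det (M [ i ≔ V j ])) ∎
  where
  open ≡-Reasoning
  rest : Fin _ → ℤ
  rest k = sumFin (λ j → c (suc j) * V (suc j) k)

-- The double expansion of a determinant along two equal rows a, with an arbitrary
-- function G of the remaining columns in place of the complementary minor.
twoRowExpansion-zero : (a : Fin (suc (suc n)) → ℤ) (G : (Fin n → Fin (suc (suc n))) → ℤ) →
  (∀ {φ ψ} → (∀ l → φ l ≡ ψ l) → G φ ≡ G ψ) →
  sumFin (λ j → signℤ (toℕ j) * a j *
    sumFin (λ k → signℤ (toℕ k) * a (punchIn j k) * G (λ l → punchIn j (punchIn k l)))) ≡ 0ℤ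
-- Terms that use column zero do so either in the first row (j = 0) or in the second (k = 0), and
-- these two groups cancel. The terms that avoid it form the same expansion with one column fewer.
twoRowExpansion-zero {n} a G G-cong = begin
  1ℤ * a zero * row₀ + sumFin (λ j → - s j * a (suc j) * (1ℤ * a zero * g j + tail j))
    ≡⟨ cong (1ℤ * a zero * row₀ +_) (trans (∑-cong (λ j → split (s j) (a (suc j)) (a zero) (g j) (tail j)))
         (∑-distrib-+ (λ j → - a zero * (s j * a (suc j) * g j)) (λ j → - s j * a (suc j) * tail j))) ⟩
  1ℤ * a zero * row₀ + (sumFin (λ j → - a zero * (s j * a (suc j) * g j))
      + sumFin (λ j → - s j * a (suc j) * tail j))
    ≡⟨ cong₂ (λ x y → 1ℤ * a zero * row₀ + (x + y))
         (*-distribˡ-∑ (- a zero) (λ j → s j * a (suc j) * g j)) (tails n a G G-cong) ⟩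
  1ℤ * a zero * row₀ + (- a zero * row₀ + 0ℤ)
    ≡⟨ cancel (a zero) row₀ ⟩
  0ℤ ∎
  where
  open ≡-Reasoning
  s : ∀ {p} → Fin p → ℤ
  s j = signℤ (toℕ j)
  g : Fin (suc n) → ℤ
  g j = G (λ l → suc (punchIn j l))
  row₀ : ℤ
  row₀ = sumFin (λ j → s j * a (suc j) * g j)
  tail : Fin (suc n) → ℤ
  tail j = sumFin (λ k → - s k * a (suc (punchIn j k)) * G (λ l → punchIn (suc j) (punchIn (suc k) l)))
  split : ∀ s b a g t → - s * b * (1ℤ * a * g + t) ≡ - a * (s * b * g) + - s * b * t
  split = solve-∀
  cancel : ∀ a r → 1ℤ * a * r + (- a * r + 0ℤ) ≡ 0ℤ
  cancel = solve-∀
  tails : ∀ n (a : Fin (suc (suc n)) → ℤ) (G : (Fin n → Fin (suc (suc n))) → ℤ) →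
    (∀ {φ ψ} → (∀ l → φ l ≡ ψ l) → G φ ≡ G ψ) →
    sumFin (λ j → - s j * a (suc j) *
      sumFin (λ k → - s k * a (suc (punchIn j k)) * G (λ l → punchIn (suc j) (punchIn (suc k) l)))) ≡ 0ℤ
  -- With two columns in all, avoiding column zero leaves no choice for the second row.
  tails zero    a G G-cong = ∑-zero {1} (λ j → ℤ.*-zeroʳ (- s j * a (suc j)))
  tails (suc n) a G G-cong =
    trans (∑-cong {suc (suc n)} (λ j → trans (cong (- s j * a (suc j) *_) (inner j))
        (negneg (s j) (a (suc j)) (sumFin (term j)))))
      (twoRowExpansion-zero (a ∘ suc) G′ G′-cong)
    where
    neg : ∀ s a g → - s * a * g ≡ - 1ℤ * (s * a * g)
    neg = solve-∀
    negneg : ∀ s a g → - s * a * (- 1ℤ * g) ≡ s * a * g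
    negneg = solve-∀
    -- Column zero, chosen by neither row, stays first among the columns passed to `G`.
    lift : (Fin n → Fin (suc (suc n))) → Fin (suc n) → Fin (suc (suc (suc n)))
    lift φ zero    = zero
    lift φ (suc l) = suc (φ l)
    G′ : (Fin n → Fin (suc (suc n))) → ℤ
    G′ φ = G (lift φ)
    G′-cong : ∀ {φ ψ} → (∀ l → φ l ≡ ψ l) → G′ φ ≡ G′ ψ
    G′-cong eq = G-cong (λ { zero → refl ; (suc l) → cong suc (eq l) })
    term : Fin (suc (suc n)) → Fin (suc n) → ℤ
    term j k = s k * a (suc (punchIn j k)) * G′ (λ l → punchIn j (punchIn k l))
    inner : ∀ j → sumFin (λ k → - s k * a (suc (punchIn j k)) *
        G (λ l → punchIn (suc j) (punchIn (suc k) l))) ≡ - 1ℤ * sumFin (term j)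
    inner j = trans
      (∑-cong (λ k → trans
        (cong (- s k * a (suc (punchIn j k)) *_)
          (G-cong {λ l → punchIn (suc j) (punchIn (suc k) l)} {lift (λ l → punchIn j (punchIn k l))}
            (λ { zero → refl ; (suc l) → refl })))
        (neg (s k) (a (suc (punchIn j k))) (G′ (λ l → punchIn j (punchIn k l))))))
      (*-distribˡ-∑ (- 1ℤ) (term j))

det-rows₀₁ : (M : Matrix (suc (suc n))) → (∀ k → M zero k ≡ M (suc zero) k) → det M ≡ 0ℤ
det-rows₀₁ M eq = trans
  (∑-cong (λ j → cong (signℤ (toℕ j) * M zero j *_) (∑-cong λ k →
     cong (λ x → signℤ (toℕ k) * x * det (minor (minor M j) k)) (sym (eq (punchIn j k))))))
  (twoRowExpansion-zero (M zero) (λ φ → det (λ i l → M (suc (suc i)) (φ l)))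
    (λ eq → det-cong (λ i k → cong (M (suc (suc i))) (eq k))))

-- Expand the vanishing determinant with u + v in both rows. Alternation is assumed for the pair i,
-- k alone, because `det-alternating` calls this lemma in the middle of its own induction.
det-swap : {i k : Fin n} → i ≢ k →
  (∀ M → (∀ l → M i l ≡ M k l) → det M ≡ 0ℤ) →
  (M : Matrix n) (u v : Fin n → ℤ) → det (M [ i ≔ u ] [ k ≔ v ]) ≡ - det (M [ i ≔ v ] [ k ≔ u ])
det-swap {n} {i} {k} i≢k alternates M u v = begin
  F u v
    ≡⟨ lem (F u u) (F u v) (F v u) (F v v) ⟩
  (F u u + 1ℤ * F v u) + 1ℤ * (F u v + 1ℤ * F v v) - F u u - F v v - F v u
    ≡⟨ cong₂ (λ x y → x + 1ℤ * y - F u u - F v v - F v u) (F-linearˡ u) (F-linearˡ v) ⟨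
  F w u + 1ℤ * F w v - F u u - F v v - F v u
    ≡⟨ cong (λ x → x - F u u - F v v - F v u) (det-linear (M [ i ≔ w ]) k u v 1ℤ) ⟨
  F w w - F u u - F v v - F v u
    ≡⟨ cong₂ (λ x y → x - y - F v v - F v u) (F-diag w) (F-diag u) ⟩
  0ℤ - 0ℤ - F v v - F v u
    ≡⟨ cong (λ x → 0ℤ - 0ℤ - x - F v u) (F-diag v) ⟩
  0ℤ - 0ℤ - 0ℤ - F v u
    ≡⟨ ℤ.+-identityˡ (- F v u) ⟩
  - F v u ∎
  where
  open ≡-Reasoning
  F : (Fin n → ℤ) → (Fin n → ℤ) → ℤ
  F x y = det (M [ i ≔ x ] [ k ≔ y ])
  w : Fin n → ℤ
  w l = u l + 1ℤ * v l
  lem : ∀ a b c d → b ≡ (a + 1ℤ * c) + 1ℤ * (b + 1ℤ * d) - a - d - c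
  lem = solve-∀
  F-diag : ∀ x → F x x ≡ 0ℤ
  F-diag x = alternates (M [ i ≔ x ] [ k ≔ x ]) λ l → cong-app
    (trans (updateAt-minimal i k (M [ i ≔ x ]) i≢k)
      (trans (updateAt-updates i M) (sym (updateAt-updates k (M [ i ≔ x ]))))) l
  F-comm : ∀ x y → F x y ≡ det (M [ k ≔ y ] [ i ≔ x ])
  F-comm x y = det-cong (λ r l → cong-app (updateAt-commutes k i (i≢k ∘ sym) M r) l)
  F-linearˡ : ∀ y → F w y ≡ F u y + 1ℤ * F v y
  F-linearˡ y = trans (F-comm w y) (trans (det-linear (M [ k ≔ y ]) i u v 1ℤ)
    (sym (cong₂ (λ a b → a + 1ℤ * b) (F-comm u y) (F-comm v y))))

-- Two equal rows below the first persist in every minor of the first-row expansion, so induction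
-- applies. If the first row is involved, the other row is swapped into second place, where
-- `det-rows₀₁` applies.
det-alternating : (i k : Fin n) → i ≢ k → (M : Matrix n) → (∀ l → M i l ≡ M k l) → det M ≡ 0ℤ
det-alternating {suc n} i₀ k₀ = cases i₀ k₀
  where
  laterRows : (i k : Fin n) → i ≢ k → (M : Matrix (suc n)) →
    (∀ l → M (suc i) l ≡ M (suc k) l) → det M ≡ 0ℤ
  laterRows i k i≢k M eq = ∑-zero (λ j → trans
    (cong (signℤ (toℕ j) * M zero j *_) (det-alternating i k i≢k (minor M j) (λ l → eq (punchIn j l))))
    (ℤ.*-zeroʳ (signℤ (toℕ j) * M zero j)))

  withFirstRow : ∀ {p} → suc p ≡ n → (k : Fin n) (M : Matrix (suc n)) →
    (∀ l → M zero l ≡ M (suc k) l) → det M ≡ 0ℤ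
  withFirstRow refl zero    M eq = det-rows₀₁ M eq
  withFirstRow refl (suc k) M eq = begin
    det M
      ≡⟨ det-cong (λ r l → sym (cong-app (unchanged r) l)) ⟩
    det (M [ one ≔ M one ] [ k′ ≔ M k′ ])
      -- Both swapped rows lie below the first, so the alternation needed here is already available
      -- from `laterRows`.
      ≡⟨ det-swap (λ ()) (laterRows zero (suc k) (λ ())) M (M one) (M k′) ⟩
    - det (M [ one ≔ M k′ ] [ k′ ≔ M one ])
      ≡⟨ cong -_ (det-rows₀₁ (M [ one ≔ M k′ ] [ k′ ≔ M one ]) eq) ⟩
    0ℤ ∎
    where
    open ≡-Reasoning
    one k′ : Fin (suc n)
    one = suc zero
    k′ = suc (suc k)
    unchanged : ∀ r → (M [ one ≔ M one ] [ k′ ≔ M k′ ]) r ≡ M r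
    unchanged r = trans (updateAt-id-local k′ (M [ one ≔ M one ]) refl r) (updateAt-id-local one M refl r)

  inhabited : Fin n → ∃ λ p → suc p ≡ n
  inhabited zero    = _ , refl
  inhabited (suc _) = _ , refl

  cases : (i k : Fin (suc n)) → i ≢ k → (M : Matrix (suc n)) → (∀ l → M i l ≡ M k l) → det M ≡ 0ℤ
  cases zero    zero    i≢k M eq = contradiction refl i≢k
  cases zero    (suc k) i≢k M eq = withFirstRow (proj₂ (inhabited k)) k M eq
  cases (suc i) zero    i≢k M eq = withFirstRow (proj₂ (inhabited i)) i M (λ l → sym (eq l))
  cases (suc i) (suc k) i≢k M eq = laterRows i k (i≢k ∘ cong suc) M eq

-- Cofactors are determinants with a unit row instead of signed minors, so that linearity in that
-- row yields both Cramer's rule and the growth bound `O-τ`.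
adjugate : Matrix n → Matrix n
adjugate X j i = det (X [ i ≔ δ j ])

-- By linearity the sum is the determinant of X with row i overwritten by row k: unchanged if k = i,
-- with a repeated row otherwise.
*-adjugate : (X : Matrix n) (k i : Fin n) → sumFin (λ j → X k j * adjugate X j i) ≡ δ k i * det X
*-adjugate X k i = trans (sym (det-∑ X i (X k) δ)) (trans (det-cong (row-≔ {M = X} {i} expand)) (cases (k Fin.≟ i)))
  where
  expand : ∀ l → sumFin (λ j → X k j * δ j l) ≡ X k l
  expand l = trans
    (∑-cong (λ j → trans (ℤ.*-comm (X k j) (δ j l)) (cong (_* X k j) (δ-sym j l))))
    (∑-δˡ l (X k))
  cases : Dec (k ≡ i) → det (X [ i ≔ X k ]) ≡ δ k i * det X
  cases (yes refl) = trans (det-cong (λ r l → cong-app (updateAt-id-local i X refl r) l))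
    (sym (trans (cong (_* det X) (δ-refl i)) (ℤ.*-identityˡ (det X))))
  cases (no k≢i) = trans
    (det-alternating k i k≢i (X [ i ≔ X k ]) (λ l → cong-app
      (trans (updateAt-minimal k i X k≢i) (sym (updateAt-updates i X))) l))
    (sym (trans (cong (_* det X) (δ-≢ k≢i)) (ℤ.*-zeroˡ (det X))))

-- Taylor expansion to first order. The remainder r may depend on h; all that matters later is that
-- it is an integer, so that the error is divisible by h².
det-expansion : (X Y : Matrix n) (h : ℤ) → ∃ λ r →
  det (λ i j → X i j + h * Y i j) ≡ det X + h * sumFin (λ i → det (X [ i ≔ Y i ])) + h * h * r
det-expansion {zero}  X Y h = 0ℤ , lem h
  where
  lem : ∀ h → 1ℤ ≡ 1ℤ + h * 0ℤ + h * h * 0ℤ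
  lem = solve-∀
det-expansion {suc n} X Y h = sumFin r , (begin
  sumFin (λ j → s j * (X zero j + h * Y zero j) * det (λ i k → mX j i k + h * mY j i k))
    ≡⟨ ∑-cong (λ j → trans (cong (s j * (X zero j + h * Y zero j) *_) (proj₂ (ih j)))
         (lem (s j) (X zero j) h (Y zero j) (det (mX j)) (dX j) (proj₁ (ih j)))) ⟩
  sumFin (λ j → s j * X zero j * det (mX j) +
    h * (s j * Y zero j * det (mX j) + s j * X zero j * dX j) + h * h * r j)
    ≡⟨ ∑-linear (h * h) (λ j → s j * X zero j * det (mX j) +
         h * (s j * Y zero j * det (mX j) + s j * X zero j * dX j)) r ⟩
  sumFin (λ j → s j * X zero j * det (mX j) +
    h * (s j * Y zero j * det (mX j) + s j * X zero j * dX j)) + h * h * sumFin r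
    ≡⟨ cong (_+ h * h * sumFin r) (∑-linear h (λ j → s j * X zero j * det (mX j))
         (λ j → s j * Y zero j * det (mX j) + s j * X zero j * dX j)) ⟩
  det X + h * sumFin (λ j → s j * Y zero j * det (mX j) + s j * X zero j * dX j) + h * h * sumFin r
    ≡⟨ cong (λ d → det X + h * d + h * h * sumFin r) derivative ⟩
  det X + h * sumFin (λ i → det (X [ i ≔ Y i ])) + h * h * sumFin r ∎)
  where
  open ≡-Reasoning
  s : Fin (suc n) → ℤ
  s j = signℤ (toℕ j)
  mX mY : Fin (suc n) → Matrix n
  mX = minor X
  mY = minor Y
  ih : ∀ j → ∃ λ r → det (λ i k → mX j i k + h * mY j i k) ≡
    det (mX j) + h * sumFin (λ i → det (mX j [ i ≔ mY j i ])) + h * h * r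
  ih j = det-expansion (mX j) (mY j) h
  dX : Fin (suc n) → ℤ
  dX j = sumFin (λ i → det (mX j [ i ≔ mY j i ]))
  r : Fin (suc n) → ℤ
  r j = s j * X zero j * proj₁ (ih j) + s j * Y zero j * dX j + h * (s j * Y zero j * proj₁ (ih j))
  lem : ∀ s x h y d d′ r → s * (x + h * y) * (d + h * d′ + h * h * r) ≡
    s * x * d + h * (s * y * d + s * x * d′) + h * h * (s * x * r + s * y * d′ + h * (s * y * r))
  lem = solve-∀
  derivative : sumFin (λ j → s j * Y zero j * det (mX j) + s j * X zero j * dX j) ≡
    sumFin (λ i → det (X [ i ≔ Y i ]))
  derivative = begin
    sumFin (λ j → s j * Y zero j * det (mX j) + s j * X zero j * dX j)
      ≡⟨ ∑-distrib-+ (λ j → s j * Y zero j * det (mX j)) (λ j → s j * X zero j * dX j) ⟩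
    det (X [ zero ≔ Y zero ]) + sumFin (λ j → s j * X zero j * dX j)
      ≡⟨ cong (det (X [ zero ≔ Y zero ]) +_) (trans
           (∑-cong (λ j → sym (*-distribˡ-∑ (s j * X zero j) (λ i → det (mX j [ i ≔ mY j i ])))))
           (∑-comm (λ j i → s j * X zero j * det (mX j [ i ≔ mY j i ])))) ⟩
    det (X [ zero ≔ Y zero ]) + sumFin (λ i → sumFin (λ j → s j * X zero j * det (mX j [ i ≔ mY j i ])))
      ≡⟨ cong (det (X [ zero ≔ Y zero ]) +_) (∑-cong (λ i → ∑-cong (λ j →
           cong (s j * X zero j *_) (det-cong (λ i′ k → sym (minor-≔ X i (Y (suc i)) j i′ k)))))) ⟩
    sumFin (λ i → det (X [ i ≔ Y i ])) ∎

-- Growth of integer sequences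

pos : ℕ → ℤ
pos t = ℤ+ suc t

-- The index t stands for the argument pos t = t + 1, so that the bound has a positive base.
data O (k : ℕ) (f : ℕ → ℤ) : Set where
  bounded : (C : ℕ) → (∀ t → ∣ f t ∣ ℕ.≤ C ℕ.* suc t ℕ.^ k) → O k f

O-cong : {f g : ℕ → ℤ} → (∀ t → f t ≡ g t) → O k f → O k g
O-cong {k = k} eq (bounded C b) = bounded C λ t → subst (λ x → ∣ x ∣ ℕ.≤ C ℕ.* suc t ℕ.^ k) (eq t) (b t)

O-const : (c : ℤ) → O 0 (λ _ → c)
O-const c = bounded ∣ c ∣ λ t → ℕ.≤-reflexive (sym (ℕ.*-identityʳ ∣ c ∣))

O-zero : O k (λ _ → 0ℤ)
O-zero = bounded 0 λ t → ℕ.z≤n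

O-+ : {f g : ℕ → ℤ} → O k f → O k g → O k (λ t → f t + g t)
O-+ {k} {f} {g} (bounded C b) (bounded C′ b′) = bounded (C ℕ.+ C′) λ t →
  ℕ.≤-trans (ℤ.∣i+j∣≤∣i∣+∣j∣ (f t) (g t))
    (ℕ.≤-trans (ℕ.+-mono-≤ (b t) (b′ t)) (ℕ.≤-reflexive (sym (ℕ.*-distribʳ-+ (suc t ℕ.^ k) C C′))))

O-* : {f g : ℕ → ℤ} → O k f → O l g → O (k ℕ.+ l) (λ t → f t * g t)
O-* {k} {l} {f} {g} (bounded C b) (bounded C′ b′) = bounded (C ℕ.* C′) λ t → begin
  ∣ f t * g t ∣                                    ≡⟨ ℤ.∣i*j∣≡∣i∣*∣j∣ (f t) (g t) ⟩
  ∣ f t ∣ ℕ.* ∣ g t ∣                              ≤⟨ ℕ.*-mono-≤ (b t) (b′ t) ⟩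
  (C ℕ.* suc t ℕ.^ k) ℕ.* (C′ ℕ.* suc t ℕ.^ l)     ≡⟨ ℕ.[m*n]*[o*p]≡[m*o]*[n*p] C (suc t ℕ.^ k) C′ (suc t ℕ.^ l) ⟩
  (C ℕ.* C′) ℕ.* (suc t ℕ.^ k ℕ.* suc t ℕ.^ l)     ≡⟨ cong (C ℕ.* C′ ℕ.*_) (ℕ.^-distribˡ-+-* (suc t) k l) ⟨
  C ℕ.* C′ ℕ.* suc t ℕ.^ (k ℕ.+ l)                 ∎
  where open ℕ.≤-Reasoning

O-scale : {f : ℕ → ℤ} (c : ℤ) → O k f → O k (λ t → c * f t)
O-scale c = O-* (O-const c)

O-mono : {f : ℕ → ℤ} → k ℕ.≤ l → O k f → O l f
O-mono k≤l (bounded C b) = bounded C λ t → ℕ.≤-trans (b t) (ℕ.*-monoʳ-≤ C (ℕ.^-monoʳ-≤ (suc t) k≤l))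

O-neg : {f : ℕ → ℤ} → O k f → O k (λ t → - f t)
O-neg {k} {f} (bounded C b) = bounded C λ t → subst (ℕ._≤ C ℕ.* suc t ℕ.^ k) (sym (ℤ.∣-i∣≡∣i∣ (f t))) (b t)

O-pos : O 1 pos
O-pos = bounded 1 λ t → ℕ.≤-reflexive (sym (trans (ℕ.*-identityˡ _) (ℕ.*-identityʳ (suc t))))

O-∑ : {F : Fin n → ℕ → ℤ} → (∀ i → O k (F i)) → O k (λ t → sumFin (λ i → F i t))
O-∑ {zero}  b = O-zero
O-∑ {suc n} b = O-+ (b zero) (O-∑ (b ∘ suc))

O-det : (M : ℕ → Matrix n) → (∀ i j → O 1 (λ t → M t i j)) → O n (λ t → det (M t))
O-det {zero}  M b = O-const 1ℤ
O-det {suc n} M b = O-∑ λ j →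
  O-* (O-scale (signℤ (toℕ j)) (b zero j)) (O-det (λ t → minor (M t) j) (λ i k → b (suc i) (punchIn j k)))

O-≔ : (M : ℕ → Fin n → Fin m → ℤ) (i : Fin n) (v : ℕ → Fin m → ℤ) →
  (∀ r j → O 1 (λ t → M t r j)) → (∀ j → O 1 (λ t → v t j)) →
  ∀ r j → O 1 (λ t → (M t [ i ≔ v t ]) r j)
O-≔ M zero    v bM bv zero    j = bv j
O-≔ M zero    v bM bv (suc r) j = bM (suc r) j
O-≔ M (suc i) v bM bv zero    j = bM zero j
O-≔ M (suc i) v bM bv (suc r) j = O-≔ (λ t → M t ∘ suc) i v (bM ∘ suc) bv r j

-- At t = C the argument C + 1 exceeds the constant of the bound: (C+1)^(k+1)·|c| ≤ C·(C+1)^k forces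
-- |c| < 1.
constant-vanishes : (c : ℤ) → O k (λ t → pos t ^ℤ suc k * c) → c ≡ 0ℤ
constant-vanishes {k} c (bounded C b) = ℤ.∣i∣≡0⇒i≡0 (ℕ.n<1⇒n≡0 (ℕ.*-cancelˡ-< (suc C) ∣ c ∣ 1
  (ℕ.<-≤-trans (ℕ.s≤s bound) (ℕ.≤-reflexive (sym (ℕ.*-identityʳ (suc C)))))))
  where
  open ℕ.≤-Reasoning
  abs-^ : ∀ j → ∣ pos C ^ℤ j ∣ ≡ suc C ℕ.^ j
  abs-^ zero    = refl
  abs-^ (suc j) = trans (ℤ.∣i*j∣≡∣i∣*∣j∣ (pos C) (pos C ^ℤ j)) (cong (suc C ℕ.*_) (abs-^ j))
  P = suc C ℕ.^ k
  bound : suc C ℕ.* ∣ c ∣ ℕ.≤ C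
  bound = ℕ.*-cancelʳ-≤ (suc C ℕ.* ∣ c ∣) C P ⦃ ℕ.m^n≢0 (suc C) k ⦄ (begin
    suc C ℕ.* ∣ c ∣ ℕ.* P           ≡⟨ ℕ.*-assoc (suc C) ∣ c ∣ P ⟩
    suc C ℕ.* (∣ c ∣ ℕ.* P)         ≡⟨ cong (suc C ℕ.*_) (ℕ.*-comm ∣ c ∣ P) ⟩
    suc C ℕ.* (P ℕ.* ∣ c ∣)         ≡⟨ ℕ.*-assoc (suc C) P ∣ c ∣ ⟨
    suc C ℕ.* P ℕ.* ∣ c ∣           ≡⟨ cong (ℕ._* ∣ c ∣) (abs-^ (suc k)) ⟨
    ∣ pos C ^ℤ suc k ∣ ℕ.* ∣ c ∣      ≡⟨ ℤ.∣i*j∣≡∣i∣*∣j∣ (pos C ^ℤ suc k) c ⟨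
    ∣ pos C ^ℤ suc k * c ∣            ≤⟨ b C ⟩
    C ℕ.* P                         ∎)

-- Characteristic polynomials

-- Agrees with `charMatrix` by `charMatrix≡char`; writing the diagonal with `δ` makes each entry
-- visibly affine in t, without a case distinction.
char : Matrix n → ℤ → Matrix n
char A t i j = t * δ i j - A i j

charPoly : Matrix n → ℤ → ℤ
charPoly A t = det (char A t)

O-char : (A : Matrix n) → ∀ i j → O 1 (λ t → char A (pos t) i j)
O-char A i j = O-+ (O-* O-pos (O-const (δ i j))) (O-mono ℕ.z≤n (O-const (- A i j)))

-- The polynomial is monic: its difference from tⁿ has degree below n. The extra factor t expresses
-- this without n - 1, so that n = 0 needs no exception.
charPoly-leading : (A : Matrix n) → O n (λ t → pos t * (charPoly A (pos t) - pos t ^ℤ n))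
charPoly-leading {zero}  A = O-cong (λ t → sym (ℤ.*-zeroʳ (pos t))) O-zero
charPoly-leading {suc n} A = O-cong (λ t → sym (expand t))
  (O-+ (O-+ (O-* O-pos (charPoly-leading A₀))
      (O-* O-pos (O-scale (- A zero zero) (O-det (λ t → char A₀ (pos t)) (O-char A₀)))))
    (O-* O-pos (O-∑ (λ j → O-* (O-const (signℤ (suc (toℕ j)) * (- A zero (suc j))))
       (O-det (λ t → minor (char A (pos t)) (suc j)) (λ i k → O-char A (suc i) (punchIn (suc j) k)))))))
  where
  A₀ : Matrix n
  A₀ i j = A (suc i) (suc j)
  q off : ℕ → ℤ
  q t = charPoly A₀ (pos t)
  -- Off the diagonal the first row is free of t, so these terms are constants times determinants of
  -- size n.
  off t = sumFin (λ j → signℤ (suc (toℕ j)) * (- A zero (suc j)) * det (minor (char A (pos t)) (suc j)))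
  off≡ : ∀ t → sumFin (λ j → signℤ (suc (toℕ j)) * char A (pos t) zero (suc j) * det (minor (char A (pos t)) (suc j)))
    ≡ off t
  off≡ t = ∑-cong (λ j → cong (λ x → signℤ (suc (toℕ j)) * x * det (minor (char A (pos t)) (suc j)))
    (trans (cong (_- A zero (suc j)) (ℤ.*-zeroʳ (pos t))) (ℤ.+-identityˡ (- A zero (suc j)))))
  regroup : ∀ t a q p o → t * (1ℤ * (t * 1ℤ - a) * q + o - t * p) ≡ t * (t * (q - p)) + t * (- a * q) + t * o
  regroup = solve-∀
  expand : ∀ t → pos t * (charPoly A (pos t) - pos t ^ℤ suc n) ≡
    pos t * (pos t * (q t - pos t ^ℤ n)) + pos t * (- A zero zero * q t) + pos t * off t
  expand t = trans
    (cong (λ o → pos t * (1ℤ * (pos t * 1ℤ - A zero zero) * q t + o - pos t ^ℤ suc n)) (off≡ t))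
    (regroup (pos t) (A zero zero) (q t) (pos t ^ℤ n) (off t))

-- Subtracting c times `charPoly-leading` turns the polynomial into its leading power, which is too
-- large for the bound unless c = 0.
charPoly-constant-vanishes : (A : Matrix n) (c : ℤ) → O n (λ t → pos t * (charPoly A (pos t) * c)) → c ≡ 0ℤ
charPoly-constant-vanishes {n} A c b = constant-vanishes {n} c
  (O-cong (λ t → lem (pos t) (charPoly A (pos t)) c (pos t ^ℤ n))
    (O-+ b (O-scale (- c) (charPoly-leading A))))
  where
  lem : ∀ t p c q → t * (p * c) + - c * (t * (p - q)) ≡ t * q * c
  lem = solve-∀

-- Seen from A the common polynomial grows with degree n only, too slowly for the leading
-- coefficient 1 that B gives it in degree m > n.
charPoly-size-≮ : (A : Matrix n) (B : Matrix m) → (∀ t → charPoly A t ≡ charPoly B t) → n ℕ.≮ m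
charPoly-size-≮ A B eq n<m = contradiction (charPoly-constant-vanishes B 1ℤ
    (O-cong (λ t → cong (pos t *_) (trans (eq (pos t)) (sym (ℤ.*-identityʳ (charPoly B (pos t))))))
      (O-mono n<m (O-* O-pos (O-det (λ t → char A (pos t)) (O-char A)))))) λ ()

charPoly-size : (A : Matrix n) (B : Matrix m) → (∀ t → charPoly A t ≡ charPoly B t) → n ≡ m
charPoly-size {n} {m} A B eq with ℕ.<-cmp n m
... | tri≈ _ n≡m _ = n≡m
... | tri< n<m _ _ = contradiction n<m (charPoly-size-≮ A B eq)
... | tri> _ _ m<n = contradiction m<n (charPoly-size-≮ B A (λ t → sym (eq t)))

-- Traces

infixl 7 _⊗_
_⊗_ : Matrix n → Matrix n → Matrix n
(P ⊗ A) i j = sumFin (λ k → P i k * A k j)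

⊗-cong : {P P′ A A′ : Matrix n} → (∀ i j → P i j ≡ P′ i j) → (∀ i j → A i j ≡ A′ i j) →
  ∀ i j → (P ⊗ A) i j ≡ (P′ ⊗ A′) i j
⊗-cong eqP eqA i j = ∑-cong (λ k → cong₂ _*_ (eqP i k) (eqA k j))

⊗-assoc : (P A B : Matrix n) → ∀ i j → ((P ⊗ A) ⊗ B) i j ≡ (P ⊗ (A ⊗ B)) i j
⊗-assoc P A B i j = begin
  sumFin (λ k → sumFin (λ l → P i l * A l k) * B k j)
    ≡⟨ ∑-cong (λ k → sym (*-distribʳ-∑ (B k j) (λ l → P i l * A l k))) ⟩
  sumFin (λ k → sumFin (λ l → P i l * A l k * B k j))
    ≡⟨ ∑-comm (λ k l → P i l * A l k * B k j) ⟩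
  sumFin (λ l → sumFin (λ k → P i l * A l k * B k j))
    ≡⟨ ∑-cong (λ l → trans (∑-cong (λ k → ℤ.*-assoc (P i l) (A l k) (B k j)))
         (*-distribˡ-∑ (P i l) (λ k → A l k * B k j))) ⟩
  sumFin (λ l → P i l * sumFin (λ k → A l k * B k j)) ∎
  where open ≡-Reasoning

tr : Matrix n → ℤ
tr P = sumFin (λ i → P i i)

-- Up to the factor `charPoly A t`, the trace of P times the resolvent of A at t, in a form free of
-- division.
τ : Matrix n → Matrix n → ℤ → ℤ
τ P A t = tr (P ⊗ adjugate (char A t))

τ-cong : {P P′ : Matrix n} → (∀ i j → P i j ≡ P′ i j) → ∀ A t → τ P A t ≡ τ P′ A t
τ-cong eq A t = ∑-cong (λ i → ⊗-cong {A = adjugate (char A t)} eq (λ _ _ → refl) i i)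

τ-linear : (P P′ A : Matrix n) (a b t : ℤ) →
  τ (λ i j → a * P i j + b * P′ i j) A t ≡ a * τ P A t + b * τ P′ A t
τ-linear P P′ A a b t = trans (∑-cong (λ i → trans
    (∑-cong (λ k → lem a (P i k) b (P′ i k) (adjA k i)))
    (linear (λ k → P i k * adjA k i) (λ k → P′ i k * adjA k i))))
  (linear (λ i → (P ⊗ adjA) i i) (λ i → (P′ ⊗ adjA) i i))
  where
  adjA = adjugate (char A t)
  lem : ∀ a p b q c → (a * p + b * q) * c ≡ a * (p * c) + b * (q * c)
  lem = solve-∀
  linear : ∀ {p} (f g : Fin p → ℤ) → sumFin (λ i → a * f i + b * g i) ≡ a * sumFin f + b * sumFin g
  linear f g = trans (∑-linear b (λ i → a * f i) g) (cong (_+ b * sumFin g) (*-distribˡ-∑ a f))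

τ-step : (P A : Matrix n) (t : ℤ) → t * τ P A t ≡ τ (P ⊗ A) A t + charPoly A t * tr P
τ-step P A t = begin
  t * τ P A t
    ≡⟨ *-distribˡ-∑ t (λ i → (P ⊗ adjA) i i) ⟨
  sumFin (λ i → t * (P ⊗ adjA) i i)
    ≡⟨ ∑-cong diagonal ⟩
  sumFin (λ i → ((P ⊗ A) ⊗ adjA) i i + charPoly A t * P i i)
    ≡⟨ ∑-linear (charPoly A t) (λ i → ((P ⊗ A) ⊗ adjA) i i) (λ i → P i i) ⟩
  τ (P ⊗ A) A t + charPoly A t * tr P ∎
  where
  open ≡-Reasoning
  adjA = adjugate (char A t)
  cramer : ∀ k i → t * adjA k i ≡ (A ⊗ adjA) k i + charPoly A t * δ k i
  cramer k i = begin
    t * adjA k i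
      ≡⟨ cong (t *_) (∑-δˡ k (λ j → adjA j i)) ⟨
    t * sumFin (λ j → δ k j * adjA j i)
      ≡⟨ *-distribˡ-∑ t (λ j → δ k j * adjA j i) ⟨
    sumFin (λ j → t * (δ k j * adjA j i))
      ≡⟨ ∑-cong (λ j → split t (δ k j) (A k j) (adjA j i)) ⟩
    sumFin (λ j → A k j * adjA j i + char A t k j * adjA j i)
      ≡⟨ ∑-distrib-+ (λ j → A k j * adjA j i) (λ j → char A t k j * adjA j i) ⟩
    (A ⊗ adjA) k i + sumFin (λ j → char A t k j * adjA j i)
      ≡⟨ cong ((A ⊗ adjA) k i +_) (trans (*-adjugate (char A t) k i) (ℤ.*-comm (δ k i) (charPoly A t))) ⟩
    (A ⊗ adjA) k i + charPoly A t * δ k i ∎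
    where
    split : ∀ t d a x → t * (d * x) ≡ a * x + (t * d - a) * x
    split = solve-∀
  diagonal : ∀ i → t * (P ⊗ adjA) i i ≡ ((P ⊗ A) ⊗ adjA) i i + charPoly A t * P i i
  diagonal i = begin
    t * sumFin (λ k → P i k * adjA k i)
      ≡⟨ *-distribˡ-∑ t (λ k → P i k * adjA k i) ⟨
    sumFin (λ k → t * (P i k * adjA k i))
      ≡⟨ ∑-cong (λ k → trans (swap t (P i k) (adjA k i)) (cong (P i k *_) (cramer k i))) ⟩
    sumFin (λ k → P i k * ((A ⊗ adjA) k i + charPoly A t * δ k i))
      ≡⟨ ∑-cong (λ k → trans (distr (P i k) ((A ⊗ adjA) k i) (charPoly A t) (δ k i))
           (cong (λ d → P i k * (A ⊗ adjA) k i + charPoly A t * (d * P i k)) (δ-sym k i))) ⟩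
    sumFin (λ k → P i k * (A ⊗ adjA) k i + charPoly A t * (δ i k * P i k))
      ≡⟨ ∑-linear (charPoly A t) (λ k → P i k * (A ⊗ adjA) k i) (λ k → δ i k * P i k) ⟩
    (P ⊗ (A ⊗ adjA)) i i + charPoly A t * sumFin (λ k → δ i k * P i k)
      ≡⟨ cong₂ (λ x y → x + charPoly A t * y) (sym (⊗-assoc P A adjA i i)) (∑-δˡ i (P i)) ⟩
    ((P ⊗ A) ⊗ adjA) i i + charPoly A t * P i i ∎
    where
    swap : ∀ t p x → t * (p * x) ≡ p * (t * x)
    swap = solve-∀
    distr : ∀ p x c d → p * (x + c * d) ≡ p * x + c * (d * p)
    distr = solve-∀

-- Degree less than n, again stated with an extra factor t. That factor is absorbed into the unit
-- row of each cofactor, leaving a determinant of size n with entries of degree at most one.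
O-τ : (P A : Matrix n) → O n (λ t → pos t * τ P A (pos t))
O-τ {n} P A = O-cong (λ t → sym (expand t)) (O-∑ λ i → O-∑ λ k → O-scale (P i k)
  -- The summand 0 gives the new row the shape u + c·v of `det-linear`.
  (O-det (λ t → char A (pos t) [ i ≔ (λ j → 0ℤ + pos t * δ k j) ])
    (O-≔ (λ t → char A (pos t)) i (λ t j → 0ℤ + pos t * δ k j) (O-char A)
      (λ j → O-+ O-zero (O-* O-pos (O-const (δ k j)))))))
  where
  open ≡-Reasoning
  X : ℕ → Matrix n
  X t = char A (pos t)
  absorb : ∀ t i k → pos t * adjugate (X t) k i ≡ det (X t [ i ≔ (λ j → 0ℤ + pos t * δ k j) ])
  absorb t i k = sym (trans (det-linear (X t) i (λ _ → 0ℤ) (δ k) (pos t))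
    (trans (cong (_+ pos t * adjugate (X t) k i) (det-zeroRow (X t) i)) (ℤ.+-identityˡ (pos t * adjugate (X t) k i))))
  swap : ∀ t p x → t * (p * x) ≡ p * (t * x)
  swap = solve-∀
  expand : ∀ t → pos t * τ P A (pos t) ≡
    sumFin (λ i → sumFin (λ k → P i k * det (X t [ i ≔ (λ j → 0ℤ + pos t * δ k j) ])))
  expand t = begin
    pos t * τ P A (pos t)
      ≡⟨ *-distribˡ-∑ (pos t) (λ i → (P ⊗ adjugate (X t)) i i) ⟨
    sumFin (λ i → pos t * sumFin (λ k → P i k * adjugate (X t) k i))
      ≡⟨ ∑-cong (λ i → sym (*-distribˡ-∑ (pos t) (λ k → P i k * adjugate (X t) k i))) ⟩
    sumFin (λ i → sumFin (λ k → pos t * (P i k * adjugate (X t) k i)))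
      ≡⟨ ∑-cong (λ i → ∑-cong (λ k → trans (swap (pos t) (P i k) (adjugate (X t) k i))
           (cong (P i k *_) (absorb t i k)))) ⟩
    sumFin (λ i → sumFin (λ k → P i k * det (X t [ i ≔ (λ j → 0ℤ + pos t * δ k j) ]))) ∎

τ-derivative : (A : Matrix n) (t h : ℤ) → ∃ λ r → charPoly A (t + h) ≡ charPoly A t + h * τ δ A t + h * h * r
τ-derivative A t h with r , eq ← det-expansion (char A t) δ h = r ,
  trans (det-cong (λ i j → lem t h (δ i j) (A i j)))
    (trans eq (cong (λ x → charPoly A t + h * x + h * h * r)
      (∑-cong (λ i → sym (∑-δˡ i (λ k → adjugate (char A t) k i))))))
  where
  lem : ∀ t h d a → (t + h) * d - a ≡ t * d - a + h * d
  lem = solve-∀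

-- After cancelling one factor, x is divisible by every positive integer, in particular by |x| + 1.
divisible-by-all : (x : ℤ) → (∀ h → ∃ λ r → ℤ+ suc h * x ≡ ℤ+ suc h * ℤ+ suc h * r) → x ≡ 0ℤ
divisible-by-all x div with r , eq ← div ∣ x ∣ = ℤ.∣i∣≡0⇒i≡0 (small ∣ r ∣ abs)
  where
  H = ℤ+ suc ∣ x ∣
  abs : ∣ x ∣ ≡ suc ∣ x ∣ ℕ.* ∣ r ∣
  abs = trans (cong ∣_∣ (ℤ.*-cancelˡ-≡ H x (H * r) (trans eq (ℤ.*-assoc H H r)))) (ℤ.∣i*j∣≡∣i∣*∣j∣ H r)
  small : ∀ r → ∣ x ∣ ≡ suc ∣ x ∣ ℕ.* r → ∣ x ∣ ≡ 0
  small zero    e = trans e (ℕ.*-zeroʳ (suc ∣ x ∣))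
  small (suc r) e = contradiction (ℕ.≤-trans (ℕ.m≤m*n (suc ∣ x ∣) (suc r)) (ℕ.≤-reflexive (sym e))) ℕ.1+n≰n

module _ {n : ℕ} (A B : Matrix n) (cospectral : ∀ t → charPoly A t ≡ charPoly B t) where

  infix 4 _≈τ_
  _≈τ_ : Matrix n → Matrix n → Set
  P ≈τ Q = ∀ t → τ P A t ≡ τ Q B t

  -- An integer polynomial function determines its derivative, which modulo every h is a difference quotient.
  δ-≈τ : δ ≈τ δ
  δ-≈τ t = ℤ.i-j≡0⇒i≡j (τ δ A t) (τ δ B t) (divisible-by-all (τ δ A t - τ δ B t) λ h →
    let rA , eqA = τ-derivative A t (ℤ+ suc h)
        rB , eqB = τ-derivative B t (ℤ+ suc h)
    in rB - rA , lem (charPoly A t) (ℤ+ suc h) (τ δ A t) (τ δ B t) rA rB (begin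
      charPoly A t + ℤ+ suc h * τ δ A t + ℤ+ suc h * ℤ+ suc h * rA  ≡⟨ eqA ⟨
      charPoly A (t + ℤ+ suc h)                                     ≡⟨ cospectral (t + ℤ+ suc h) ⟩
      charPoly B (t + ℤ+ suc h)                                     ≡⟨ eqB ⟩
      charPoly B t + ℤ+ suc h * τ δ B t + ℤ+ suc h * ℤ+ suc h * rB
        ≡⟨ cong (λ p → p + ℤ+ suc h * τ δ B t + ℤ+ suc h * ℤ+ suc h * rB) (cospectral t) ⟨
      charPoly A t + ℤ+ suc h * τ δ B t + ℤ+ suc h * ℤ+ suc h * rB  ∎))
    where
    open ≡-Reasoning
    before : ∀ p h a b r s → h * (a - b) ≡ (p + h * a + h * h * r) - (p + h * b + h * h * s) + h * h * (s - r)
    before = solve-∀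
    lem : ∀ p h a b r s → p + h * a + h * h * r ≡ p + h * b + h * h * s → h * (a - b) ≡ h * h * (s - r)
    lem p h a b r s eq = trans (before p h a b r s)
      (trans (cong (_+ h * h * (s - r)) (ℤ.i≡j⇒i-j≡0 eq))
        (ℤ.+-identityˡ (h * h * (s - r))))

  ≈τ⇒tr≡ : {P Q : Matrix n} → P ≈τ Q → tr P ≡ tr Q
  ≈τ⇒tr≡ {P} {Q} P≈Q = ℤ.i-j≡0⇒i≡j (tr P) (tr Q) (charPoly-constant-vanishes A (tr P - tr Q)
    (O-cong (λ t → sym (lem (pos t) (charPoly A (pos t)) (tr P) (tr Q)
        (τ (Q ⊗ B) B (pos t)) (τ (P ⊗ A) A (pos t)) (eq (pos t))))
      (O-+ (O-τ (Q ⊗ B) B) (O-neg (O-τ (P ⊗ A) A)))))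
    where
    eq : ∀ t → τ (P ⊗ A) A t + charPoly A t * tr P ≡ τ (Q ⊗ B) B t + charPoly A t * tr Q
    eq t = trans (sym (τ-step P A t)) (trans (cong (t *_) (P≈Q t)) (trans (τ-step Q B t)
      (cong (λ p → τ (Q ⊗ B) B t + p * tr Q) (sym (cospectral t)))))
    before : ∀ t p x y q r → t * (p * (x - y)) ≡ t * ((r + p * x) - (q + p * y)) + (t * q + - (t * r))
    before = solve-∀
    lem : ∀ t p x y q r → r + p * x ≡ q + p * y → t * (p * (x - y)) ≡ t * q + - (t * r)
    lem t p x y q r eq = trans (before t p x y q r) (trans (cong (_+ (t * q + - (t * r)))
      (trans (cong (t *_) (ℤ.i≡j⇒i-j≡0 eq)) (ℤ.*-zeroʳ t)))
      (ℤ.+-identityˡ (t * q + - (t * r))))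

  ⊗-≈τ : {P Q : Matrix n} → P ≈τ Q → P ⊗ A ≈τ Q ⊗ B
  ⊗-≈τ {P} {Q} P≈Q t = trans (rearrange (τ-step P A t)) (trans
    (cong₂ (λ x y → x - y) (cong (t *_) (P≈Q t)) (cong₂ _*_ (cospectral t) (≈τ⇒tr≡ {P} {Q} P≈Q)))
    (sym (rearrange (τ-step Q B t))))
    where
    lem : ∀ y z → y ≡ y + z - z
    lem = solve-∀
    rearrange : ∀ {x y z} → x ≡ y + z → y ≡ x - z
    rearrange {x} {y} {z} eq = trans (lem y z) (cong (_- z) (sym eq))

-- The quadratic polynomial 4A² + cA and traces of its powers

quad : ℤ → Matrix n → Matrix n
quad c A i j = ℤ+ 4 * (A ⊗ A) i j + c * A i j

⊗-linear : (P X Y : Matrix n) (a b : ℤ) → ∀ i j →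
  (P ⊗ (λ k l → a * X k l + b * Y k l)) i j ≡ a * (P ⊗ X) i j + b * (P ⊗ Y) i j
⊗-linear P X Y a b i j = trans
  (∑-cong (λ k → lem (P i k) a (X k j) b (Y k j)))
  (trans (∑-linear b (λ k → a * (P i k * X k j)) (λ k → P i k * Y k j))
    (cong (_+ b * (P ⊗ Y) i j) (*-distribˡ-∑ a (λ k → P i k * X k j))))
  where
  lem : ∀ p a x b y → p * (a * x + b * y) ≡ a * (p * x) + b * (p * y)
  lem = solve-∀

⊗-quad : (P A : Matrix n) (c : ℤ) → ∀ i j →
  (P ⊗ quad c A) i j ≡ ℤ+ 4 * ((P ⊗ A) ⊗ A) i j + c * (P ⊗ A) i j
⊗-quad P A c i j = trans (⊗-linear P (A ⊗ A) A (ℤ+ 4) c i j)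
  (cong (λ x → ℤ+ 4 * x + c * (P ⊗ A) i j) (sym (⊗-assoc P A A i j)))

module _ {n : ℕ} (A B : Matrix n) (cospectral : ∀ t → charPoly A t ≡ charPoly B t) (c : ℤ) where
  private
    MA = quad c A
    MB = quad c B
    infix 4 _≈_
    _≈_ = _≈τ_ A B cospectral

  quad-≈τ : {P Q : Matrix n} → P ≈ Q → P ⊗ MA ≈ Q ⊗ MB
  quad-≈τ {P} {Q} P≈Q t = trans (expand P A) (trans
    (cong₂ (λ x y → ℤ+ 4 * x + c * y) (PAA≈QBB t) (PA≈QB t)) (sym (expand Q B)))
    where
    PA≈QB = ⊗-≈τ A B cospectral {P} {Q} P≈Q
    PAA≈QBB = ⊗-≈τ A B cospectral {P ⊗ A} {Q ⊗ B} PA≈QB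
    expand : ∀ P A → τ (P ⊗ quad c A) A t ≡ ℤ+ 4 * τ ((P ⊗ A) ⊗ A) A t + c * τ (P ⊗ A) A t
    expand P A = trans (τ-cong (⊗-quad P A c) A t) (τ-linear ((P ⊗ A) ⊗ A) (P ⊗ A) A (ℤ+ 4) c t)

  private
    M¹ : MA ≈ MB
    M¹ t = trans (τ-cong (λ i j → sym (∑-δˡ i (λ k → MA k j))) A t)
      (trans (quad-≈τ {δ} {δ} (δ-≈τ A B cospectral) t) (τ-cong (λ i j → ∑-δˡ i (λ k → MB k j)) B t))
    M² : MA ⊗ MA ≈ MB ⊗ MB
    M² = quad-≈τ {MA} {MB} M¹
    M⁴ : (MA ⊗ MA ⊗ MA) ⊗ MA ≈ (MB ⊗ MB ⊗ MB) ⊗ MB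
    M⁴ = quad-≈τ {MA ⊗ MA ⊗ MA} {MB ⊗ MB ⊗ MB} (quad-≈τ {MA ⊗ MA} {MB ⊗ MB} M²)

  tr-quad : tr MA ≡ tr MB
  tr-quad = ≈τ⇒tr≡ A B cospectral {MA} {MB} M¹

  tr-quad² : tr (MA ⊗ MA) ≡ tr (MB ⊗ MB)
  tr-quad² = ≈τ⇒tr≡ A B cospectral {MA ⊗ MA} {MB ⊗ MB} M²

  tr-quad⁴ : tr ((MA ⊗ MA) ⊗ (MA ⊗ MA)) ≡ tr ((MB ⊗ MB) ⊗ (MB ⊗ MB))
  tr-quad⁴ = trans (∑-cong (λ i → sym (⊗-assoc (MA ⊗ MA) MA MA i i)))
    (trans (≈τ⇒tr≡ A B cospectral {MA ⊗ MA ⊗ MA ⊗ MA} {MB ⊗ MB ⊗ MB ⊗ MB} M⁴)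
      (∑-cong (λ i → ⊗-assoc (MB ⊗ MB) MB MB i i)))

-- Sums of squares

0≤i*i : ∀ i → 0ℤ ≤ i * i
0≤i*i (ℤ+ zero)    = ℤ.≤-refl
0≤i*i (ℤ+ suc n)   = ℤ.+≤+ ℕ.z≤n
0≤i*i ℤ.-[1+ n ]   = ℤ.+≤+ ℕ.z≤n

i*i≡0⇒i≡0 : ∀ i → i * i ≡ 0ℤ → i ≡ 0ℤ
i*i≡0⇒i≡0 i eq with ℤ.i*j≡0⇒i≡0∨j≡0 i eq
... | inj₁ p = p
... | inj₂ p = p

0≤+⇒≡0 : ∀ {i j} → 0ℤ ≤ i → 0ℤ ≤ j → i + j ≡ 0ℤ → i ≡ 0ℤ × j ≡ 0ℤ
0≤+⇒≡0 {ℤ+ a} {ℤ+ b} _ _ eq =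
  cong ℤ+_ (ℕ.m+n≡0⇒m≡0 a (ℤ.+-injective eq)) , cong ℤ+_ (ℕ.m+n≡0⇒n≡0 a (ℤ.+-injective eq))

∑-nonneg : {f : Fin n → ℤ} → (∀ i → 0ℤ ≤ f i) → 0ℤ ≤ sumFin f
∑-nonneg {zero}  f≥0 = ℤ.≤-refl
∑-nonneg {suc n} f≥0 = ℤ.+-mono-≤ (f≥0 zero) (∑-nonneg (f≥0 ∘ suc))

∑-nonneg-zero : {f : Fin n → ℤ} → (∀ i → 0ℤ ≤ f i) → sumFin f ≡ 0ℤ → ∀ i → f i ≡ 0ℤ
∑-nonneg-zero f≥0 eq zero    = proj₁ (0≤+⇒≡0 (f≥0 zero) (∑-nonneg (f≥0 ∘ suc)) eq)
∑-nonneg-zero f≥0 eq (suc i) = ∑-nonneg-zero (f≥0 ∘ suc) (proj₂ (0≤+⇒≡0 (f≥0 zero) (∑-nonneg (f≥0 ∘ suc)) eq)) i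

∑∑-* : (f : Fin n → ℤ) (g : Fin m → ℤ) →
  sumFin (λ i → sumFin (λ j → f i * g j)) ≡ sumFin f * sumFin g
∑∑-* f g = trans (∑-cong (λ i → *-distribˡ-∑ (f i) g)) (*-distribʳ-∑ (sumFin g) f)

-- The hypothesis compares power sums of the squared eigenvalues of M, so at most one of these is nonzero.
-- The sum of the squares of all 2×2 minors of M is 2 (tr M²)² − 2 tr M⁴.
rankOne : (M : Matrix n) → (∀ i j → M i j ≡ M j i) →
  tr (M ⊗ M) * tr (M ⊗ M) ≡ tr ((M ⊗ M) ⊗ (M ⊗ M)) → ∀ i j → M i i * M j j ≡ M i j * M i j
rankOne {n} M M-sym trace i j = ℤ.i-j≡0⇒i≡j (M i i * M j j) (M i j * M i j)
  (trans (cong (λ x → M i i * M j j - M i j * x) (M-sym i j)) (i*i≡0⇒i≡0 (minor₂ i j i j)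
    -- The vanishing of the total descends through four nested sums to the single minor on rows i, j
    -- and columns i, j.
    (∑-nonneg-zero (λ l → 0≤i*i (minor₂ i j i l))
      (∑-nonneg-zero (λ k → ∑-nonneg (λ l → 0≤i*i (minor₂ i j k l)))
        (∑-nonneg-zero (λ j → V≥0 i j)
          (∑-nonneg-zero (λ i → ∑-nonneg (V≥0 i)) total i) j) i) j)))
  where
  open ≡-Reasoning
  minor₂ : Fin n → Fin n → Fin n → Fin n → ℤ
  minor₂ i j k l = M i k * M j l - M i l * M j k
  V : Fin n → Fin n → ℤ
  V i j = sumFin (λ k → sumFin (λ l → minor₂ i j k l * minor₂ i j k l))
  V≥0 : ∀ i j → 0ℤ ≤ V i j
  V≥0 i j = ∑-nonneg (λ k → ∑-nonneg (λ l → 0≤i*i (minor₂ i j k l)))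
  S : Matrix n
  S = M ⊗ M
  S-rows : ∀ i j → sumFin (λ k → M i k * M j k) ≡ S i j
  S-rows i j = ∑-cong (λ k → cong (M i k *_) (M-sym j k))
  square : ∀ a b c e → (a * b - c * e) * (a * b - c * e) ≡
    (a * a) * (b * b) + ((e * e) * (c * c) + - ℤ+ 2 * ((a * e) * (b * c)))
  square = solve-∀
  -- Lagrange's identity: the squared minors of rows i and j add up to twice their Gram determinant.
  -- The three products stay apart because each is summed over i and j separately.
  V-value : ∀ i j → V i j ≡ S i i * S j j + (S j j * S i i + - ℤ+ 2 * (S i j * S j i))
  V-value i j = begin
    V i j
      ≡⟨ ∑-cong (λ k → ∑-cong (λ l → square (M i k) (M j l) (M i l) (M j k))) ⟩
    sumFin (λ k → sumFin (λ l → (M i k * M i k) * (M j l * M j l) +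
      ((M j k * M j k) * (M i l * M i l) + - ℤ+ 2 * ((M i k * M j k) * (M j l * M i l)))))
      ≡⟨ ∑-cong (λ k → ∑-linear₃ (- ℤ+ 2)
           (λ l → a i i k * a j j l) (λ l → a j j k * a i i l) (λ l → a i j k * a j i l)) ⟩
    sumFin (λ k → sumFin (λ l → a i i k * a j j l) +
      (sumFin (λ l → a j j k * a i i l) + - ℤ+ 2 * sumFin (λ l → a i j k * a j i l)))
      ≡⟨ ∑-linear₃ (- ℤ+ 2) (λ k → sumFin (λ l → a i i k * a j j l))
           (λ k → sumFin (λ l → a j j k * a i i l)) (λ k → sumFin (λ l → a i j k * a j i l)) ⟩
    Σa i i j j + (Σa j j i i + - ℤ+ 2 * Σa i j j i)
      ≡⟨ cong₂ _+_ (Σa-value i i j j) (cong₂ (λ x y → x + - ℤ+ 2 * y) (Σa-value j j i i) (Σa-value i j j i)) ⟩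
    S i i * S j j + (S j j * S i i + - ℤ+ 2 * (S i j * S j i)) ∎
    where
    a : Fin n → Fin n → Fin n → ℤ
    a i j k = M i k * M j k
    Σa : Fin n → Fin n → Fin n → Fin n → ℤ
    Σa i j i′ j′ = sumFin (λ k → sumFin (λ l → a i j k * a i′ j′ l))
    Σa-value : ∀ i j i′ j′ → Σa i j i′ j′ ≡ S i j * S i′ j′
    Σa-value i j i′ j′ = trans (∑∑-* (a i j) (a i′ j′)) (cong₂ _*_ (S-rows i j) (S-rows i′ j′))
  cancel : ∀ x → x + (x + - ℤ+ 2 * x) ≡ 0ℤ
  cancel = solve-∀
  total : sumFin (λ i → sumFin (V i)) ≡ 0ℤ
  total = begin
    sumFin (λ i → sumFin (V i))
      ≡⟨ ∑-cong (λ i → trans (∑-cong (V-value i)) (∑-linear₃ (- ℤ+ 2)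
           (λ j → S i i * S j j) (λ j → S j j * S i i) (λ j → S i j * S j i))) ⟩
    sumFin (λ i → sumFin (λ j → S i i * S j j) + (sumFin (λ j → S j j * S i i) + - ℤ+ 2 * (S ⊗ S) i i))
      ≡⟨ ∑-linear₃ (- ℤ+ 2) (λ i → sumFin (λ j → S i i * S j j))
           (λ i → sumFin (λ j → S j j * S i i)) (λ i → (S ⊗ S) i i) ⟩
    sumFin (λ i → sumFin (λ j → S i i * S j j)) + (sumFin (λ i → sumFin (λ j → S j j * S i i)) + - ℤ+ 2 * tr (S ⊗ S))
      ≡⟨ cong₂ (λ x y → x + (y + - ℤ+ 2 * tr (S ⊗ S))) (∑∑-* (λ i → S i i) (λ j → S j j))
           (trans (∑-comm (λ i j → S j j * S i i)) (∑∑-* (λ i → S i i) (λ j → S j j))) ⟩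
    tr S * tr S + (tr S * tr S + - ℤ+ 2 * tr (S ⊗ S))
      ≡⟨ cong (λ x → x + (x + - ℤ+ 2 * tr (S ⊗ S))) trace ⟩
    tr (S ⊗ S) + (tr (S ⊗ S) + - ℤ+ 2 * tr (S ⊗ S))
      ≡⟨ cancel (tr (S ⊗ S)) ⟩
    0ℤ ∎

constant-trace : (M : Matrix n) (b : ℤ) → (∀ i j → M i j ≡ b) →
  tr (M ⊗ M) * tr (M ⊗ M) ≡ tr ((M ⊗ M) ⊗ (M ⊗ M))
constant-trace {n} M b M≡b = begin
  tr (M ⊗ M) * tr (M ⊗ M)
    ≡⟨ cong₂ _*_ trS trS ⟩
  N * s * (N * s)
    ≡⟨ lem N s ⟩
  N * (N * (s * s))
    ≡⟨ trans (∑-cong {n} (λ i → trans (∑-cong (λ k → cong₂ _*_ (S i k) (S k i))) (∑-const {n} (s * s))))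
         (∑-const {n} (N * (s * s))) ⟨
  tr ((M ⊗ M) ⊗ (M ⊗ M)) ∎
  where
  open ≡-Reasoning
  N s : ℤ
  N = ℤ+ n
  s = N * (b * b)
  S : ∀ i j → (M ⊗ M) i j ≡ s
  S i j = trans (∑-cong (λ k → cong₂ _*_ (M≡b i k) (M≡b k j))) (∑-const {n} (b * b))
  trS : tr (M ⊗ M) ≡ N * s
  trS = trans (∑-cong (λ i → S i i)) (∑-const {n} s)
  lem : ∀ n s → n * s * (n * s) ≡ n * (n * (s * s))
  lem = solve-∀

-- Binary words

ham : Vec Bool d → Vec Bool d → ℕ
ham []      []      = 0
ham (x ∷ u) (y ∷ v) = b2n (x xor y) ℕ.+ ham u v

ham-sym : (u v : Vec Bool d) → ham u v ≡ ham v u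
ham-sym []      []      = refl
ham-sym (x ∷ u) (y ∷ v) = cong₂ ℕ._+_ (cong b2n (xor-comm x y)) (ham-sym u v)

ham-refl : (u : Vec Bool d) → ham u u ≡ 0
ham-refl []          = refl
ham-refl (true ∷ u)  = ham-refl u
ham-refl (false ∷ u) = ham-refl u

ham≡0⇒≡ : (u v : Vec Bool d) → ham u v ≡ 0 → u ≡ v
ham≡0⇒≡ []          []          eq = refl
ham≡0⇒≡ (true ∷ u)  (true ∷ v)  eq = cong (true ∷_) (ham≡0⇒≡ u v eq)
ham≡0⇒≡ (false ∷ u) (false ∷ v) eq = cong (false ∷_) (ham≡0⇒≡ u v eq)

-- The word w is u with its first disagreement with v corrected.
ham-step : (u v : Vec Bool d) {k : ℕ} → ham u v ≡ suc k → ∃ λ w → ham u w ≡ 1 × ham w v ≡ k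
ham-step []          []          ()
ham-step (true ∷ u)  (false ∷ v) eq = false ∷ u , cong suc (ham-refl u) , ℕ.suc-injective eq
ham-step (false ∷ u) (true ∷ v)  eq = true ∷ u , cong suc (ham-refl u) , ℕ.suc-injective eq
ham-step (true ∷ u)  (true ∷ v)  eq = let w , p , q = ham-step u v eq in true ∷ w , p , q
ham-step (false ∷ u) (false ∷ v) eq = let w , p , q = ham-step u v eq in false ∷ w , p , q

-- The head is the most significant digit, as `hamming (suc d)` compares bit d first. The shape of
-- the injections follows the reduction of `2 ^ suc d` to `2 ^ d + (2 ^ d + 0)`.
enc : Vec Bool d → Fin (2 ^ d)
enc []                  = zero
enc {suc d} (false ∷ v) = enc v ↑ˡ (2 ^ d ℕ.+ 0)
enc {suc d} (true ∷ v)  = 2 ^ d ↑ʳ (enc v ↑ˡ 0)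

enc-surjective : ∀ d (i : Fin (2 ^ d)) → ∃ λ (v : Vec Bool d) → enc v ≡ i
enc-surjective zero    zero = [] , refl
enc-surjective (suc d) i with splitAt (2 ^ d) i in eq
... | inj₁ j = let v , p = enc-surjective d j in
  false ∷ v , trans (cong (_↑ˡ (2 ^ d ℕ.+ 0)) p) (Fin.splitAt⁻¹-↑ˡ eq)
... | inj₂ j with splitAt (2 ^ d) j in eq′
...   | inj₁ k = let v , p = enc-surjective d k in
  true ∷ v , trans (cong (2 ^ d ↑ʳ_) (trans (cong (_↑ˡ 0) p) (Fin.splitAt⁻¹-↑ˡ eq′))) (Fin.splitAt⁻¹-↑ʳ eq)

enc-heads : (u v : Vec Bool d) → enc (false ∷ u) ≢ enc (true ∷ v)
enc-heads {d} u v eq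
  with () ← trans (sym (Fin.splitAt-↑ˡ (2 ^ d) (enc u) (2 ^ d ℕ.+ 0)))
    (trans (cong (splitAt (2 ^ d)) eq) (Fin.splitAt-↑ʳ (2 ^ d) (2 ^ d ℕ.+ 0) (enc v ↑ˡ 0)))

enc-injective : (u v : Vec Bool d) → enc u ≡ enc v → u ≡ v
enc-injective [] [] eq = refl
enc-injective {suc d} (false ∷ u) (false ∷ v) eq =
  cong (false ∷_) (enc-injective u v (Fin.↑ˡ-injective (2 ^ d ℕ.+ 0) (enc u) (enc v) eq))
enc-injective {suc d} (true ∷ u)  (true ∷ v)  eq =
  cong (true ∷_) (enc-injective u v (Fin.↑ˡ-injective 0 (enc u) (enc v)
    (Fin.↑ʳ-injective (2 ^ d) (enc u ↑ˡ 0) (enc v ↑ˡ 0) eq)))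
enc-injective {suc d} (false ∷ u) (true ∷ v)  eq = contradiction eq (enc-heads u v)
enc-injective {suc d} (true ∷ u)  (false ∷ v) eq = contradiction (sym eq) (enc-heads v u)

parity-2x+ : ∀ x a → parity (x ℕ.+ (x ℕ.+ 0) ℕ.+ a) ≡ parity a
parity-2x+ zero    a = refl
parity-2x+ (suc x) a rewrite ℕ.+-suc x (x ℕ.+ 0) = parity-2x+ x a

⌊2x+/2⌋ : ∀ x a → ⌊ x ℕ.+ (x ℕ.+ 0) ℕ.+ a /2⌋ ≡ x ℕ.+ ⌊ a /2⌋
⌊2x+/2⌋ zero    a = refl
⌊2x+/2⌋ (suc x) a rewrite ℕ.+-suc x (x ℕ.+ 0) = cong suc (⌊2x+/2⌋ x a)

⌊/2⌋<x : ∀ a x → a ℕ.< x ℕ.+ (x ℕ.+ 0) → ⌊ a /2⌋ ℕ.< x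
⌊/2⌋<x zero          (suc x) lt = ℕ.z<s
⌊/2⌋<x (suc zero)    (suc x) lt = ℕ.z<s
⌊/2⌋<x (suc (suc a)) (suc x) lt rewrite ℕ.+-suc x (x ℕ.+ 0) = ℕ.s<s (⌊/2⌋<x a x (ℕ.s<s⁻¹ (ℕ.s<s⁻¹ lt)))

bit-top-false : ∀ d a → a ℕ.< 2 ^ d → bit a d ≡ false
bit-top-false zero    zero lt = refl
bit-top-false zero    (suc a) (ℕ.s<s ())
bit-top-false (suc d) a    lt = bit-top-false d ⌊ a /2⌋ (⌊/2⌋<x a (2 ^ d) lt)

bit-top-true : ∀ d a → a ℕ.< 2 ^ d → bit (2 ^ d ℕ.+ a) d ≡ true
bit-top-true zero    zero lt = refl
bit-top-true zero    (suc a) (ℕ.s<s ())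
bit-top-true (suc d) a    lt = trans (cong (λ x → bit x d) (⌊2x+/2⌋ (2 ^ d) a))
  (bit-top-true d ⌊ a /2⌋ (⌊/2⌋<x a (2 ^ d) lt))

bit-lower : ∀ d a k → k ℕ.< d → bit (2 ^ d ℕ.+ a) k ≡ bit a k
bit-lower (suc d) a zero    lt = parity-2x+ (2 ^ d) a
bit-lower (suc d) a (suc k) lt = trans (cong (λ x → bit x k) (⌊2x+/2⌋ (2 ^ d) a))
  (bit-lower d ⌊ a /2⌋ k (ℕ.s<s⁻¹ lt))

hamming-cong : ∀ d {a a′ b b′} → (∀ k → k ℕ.< d → bit a k ≡ bit a′ k) →
  (∀ k → k ℕ.< d → bit b k ≡ bit b′ k) → hamming d a b ≡ hamming d a′ b′
hamming-cong zero    p q = refl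
hamming-cong (suc d) p q = cong₂ ℕ._+_ (cong b2n (cong₂ _xor_ (p d (ℕ.n<1+n d)) (q d (ℕ.n<1+n d))))
  (hamming-cong d (λ k lt → p k (ℕ.m<n⇒m<1+n lt)) (λ k lt → q k (ℕ.m<n⇒m<1+n lt)))

enc-bit-top : ∀ x (v : Vec Bool d) → bit (toℕ (enc (x ∷ v))) d ≡ x
enc-bit-top {d} false v rewrite Fin.toℕ-↑ˡ (enc v) (2 ^ d ℕ.+ 0) = bit-top-false d (toℕ (enc v)) (Fin.toℕ<n (enc v))
enc-bit-top {d} true  v rewrite Fin.toℕ-↑ʳ (2 ^ d) (enc v ↑ˡ 0) | Fin.toℕ-↑ˡ (enc v) 0 =
  bit-top-true d (toℕ (enc v)) (Fin.toℕ<n (enc v))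

enc-bit-lower : ∀ x (v : Vec Bool d) k → k ℕ.< d → bit (toℕ (enc (x ∷ v))) k ≡ bit (toℕ (enc v)) k
enc-bit-lower {d} false v k lt rewrite Fin.toℕ-↑ˡ (enc v) (2 ^ d ℕ.+ 0) = refl
enc-bit-lower {d} true  v k lt rewrite Fin.toℕ-↑ʳ (2 ^ d) (enc v ↑ˡ 0) | Fin.toℕ-↑ˡ (enc v) 0 =
  bit-lower d (toℕ (enc v)) k lt

hamming-enc : (u v : Vec Bool d) → hamming d (toℕ (enc u)) (toℕ (enc v)) ≡ ham u v
hamming-enc []      []      = refl
hamming-enc {suc d} (x ∷ u) (y ∷ v) = cong₂ ℕ._+_
  (cong b2n (cong₂ _xor_ (enc-bit-top x u) (enc-bit-top y v)))
  (trans (hamming-cong d (enc-bit-lower x u) (enc-bit-lower y v)) (hamming-enc u v))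

-- Distances in the cube

b2n-xor-triangle : ∀ x y z → b2n (x xor z) ℕ.≤ b2n (x xor y) ℕ.+ b2n (y xor z)
b2n-xor-triangle false false z     = ℕ.≤-refl
b2n-xor-triangle true  true  z     = ℕ.m≤n+m (b2n (true xor z)) 0
b2n-xor-triangle false true  false = ℕ.z≤n
b2n-xor-triangle false true  true  = ℕ.s≤s ℕ.z≤n
b2n-xor-triangle true  false false = ℕ.s≤s ℕ.z≤n
b2n-xor-triangle true  false true  = ℕ.z≤n

hamming-triangle : ∀ d a b c → hamming d a c ℕ.≤ hamming d a b ℕ.+ hamming d b c
hamming-triangle zero    a b c = ℕ.z≤n
hamming-triangle (suc d) a b c = ℕ.≤-trans
  (ℕ.+-mono-≤ (b2n-xor-triangle (bit a d) (bit b d) (bit c d)) (hamming-triangle d a b c))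
  (ℕ.≤-reflexive (interchange ℕ.+-commutativeSemigroup
    (b2n (bit a d xor bit b d)) (b2n (bit b d xor bit c d)) (hamming d a b) (hamming d b c)))

hamming-≤-walk : ∀ {x y k} → Walk (Cube d) x y k → hamming d (toℕ x) (toℕ y) ℕ.≤ k
hamming-≤-walk {d} {x} here = ℕ.≤-reflexive (hamming-diag d (toℕ x))
  where
  hamming-diag : ∀ d a → hamming d a a ≡ 0
  hamming-diag zero    a = refl
  hamming-diag (suc d) a with bit a d
  ... | true  = hamming-diag d a
  ... | false = hamming-diag d a
hamming-≤-walk {d} {x} {z} (step {y = y} a w) = ℕ.≤-trans (hamming-triangle d (toℕ x) (toℕ y) (toℕ z))
  (ℕ.+-mono-≤ (ℕ.≤-reflexive (ℕ.≡ᵇ⇒≡ (hamming d (toℕ x) (toℕ y)) 1 a)) (hamming-≤-walk {d} w))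

ham-walk : ∀ k (u v : Vec Bool d) → ham u v ≡ k → Walk (Cube d) (enc u) (enc v) k
ham-walk zero    u v eq rewrite ham≡0⇒≡ u v eq = here
ham-walk {d} (suc k) u v eq = let w , p , q = ham-step u v eq in
  step (ℕ.≡⇒≡ᵇ (hamming d (toℕ (enc u)) (toℕ (enc w))) 1 (trans (hamming-enc u w) p)) (ham-walk k w v q)

cube-distance : ∀ d {DQ} → IsDistanceMatrix (Cube d) DQ → (u v : Vec Bool d) → DQ (enc u) (enc v) ≡ ham u v
cube-distance d {DQ} isD u v = let w , shortest = isD (enc u) (enc v) in
  ℕ.≤-antisym (shortest (ham u v) (ham-walk (ham u v) u v refl))
    (subst (ℕ._≤ DQ (enc u) (enc v)) (hamming-enc u v) (hamming-≤-walk {d} w))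

-- Sums over binary words

∑V : (Vec Bool d → ℤ) → ℤ
∑V {zero}  f = f []
∑V {suc d} f = ∑V (f ∘ (false ∷_)) + ∑V (f ∘ (true ∷_))

∑V-cong : {f g : Vec Bool d → ℤ} → (∀ v → f v ≡ g v) → ∑V f ≡ ∑V g
∑V-cong {zero}  eq = eq []
∑V-cong {suc d} eq = cong₂ _+_ (∑V-cong (λ v → eq (false ∷ v))) (∑V-cong (λ v → eq (true ∷ v)))

∑-splitAt : ∀ m {k} (f : Fin (m ℕ.+ k) → ℤ) → sumFin f ≡ sumFin (λ i → f (i ↑ˡ k)) + sumFin (λ j → f (m ↑ʳ j))
∑-splitAt zero    f = sym (ℤ.+-identityˡ (sumFin f))
∑-splitAt (suc m) {k} f = trans (cong (f zero +_) (∑-splitAt m (f ∘ suc)))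
  (sym (ℤ.+-assoc (f zero) (sumFin (λ i → f (suc (i ↑ˡ k)))) (sumFin (λ j → f (suc (m ↑ʳ j))))))

∑-enc : ∀ d (f : Fin (2 ^ d) → ℤ) → sumFin f ≡ ∑V (λ (v : Vec Bool d) → f (enc v))
∑-enc zero    f = ℤ.+-identityʳ (f zero)
∑-enc (suc d) f = trans (∑-splitAt (2 ^ d) f) (cong₂ _+_ (∑-enc d (λ i → f (i ↑ˡ (2 ^ d ℕ.+ 0))))
  (trans (∑-splitAt (2 ^ d) (λ j → f (2 ^ d ↑ʳ j)))
    (trans (ℤ.+-identityʳ (sumFin (λ i → f (2 ^ d ↑ʳ (i ↑ˡ 0))))) (∑-enc d (λ i → f (2 ^ d ↑ʳ (i ↑ˡ 0)))))))

H : Vec Bool d → Vec Bool d → ℤ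
H u v = ℤ+ ham u v

2^ : ℕ → ℤ
2^ d = ℤ+ (2 ^ d)

-- Fixing the first letter of w shifts its distances to two given words by 0 or 1 each; a and b
-- stand for these shifts.
∑V-affine : (a b : ℤ) (f g : Vec Bool d → ℤ) → ∑V (λ w → (a + f w) * (b + g w)) ≡
  a * b * 2^ d + a * ∑V g + b * ∑V f + ∑V (λ w → f w * g w)
∑V-affine {zero}  a b f g = lem a b (f []) (g [])
  where
  lem : ∀ a b f g → (a + f) * (b + g) ≡ a * b * 1ℤ + a * g + b * f + f * g
  lem = solve-∀
∑V-affine {suc d} a b f g = trans
  (cong₂ _+_ (∑V-affine a b (f ∘ (false ∷_)) (g ∘ (false ∷_))) (∑V-affine a b (f ∘ (true ∷_)) (g ∘ (true ∷_))))
  (lem a b (2^ d) (∑V (f ∘ (false ∷_))) (∑V (f ∘ (true ∷_))) (∑V (g ∘ (false ∷_))) (∑V (g ∘ (true ∷_)))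
    (∑V (λ w → f (false ∷ w) * g (false ∷ w))) (∑V (λ w → f (true ∷ w) * g (true ∷ w))))
  where
  lem : ∀ a b n f₀ f₁ g₀ g₁ p₀ p₁ → (a * b * n + a * g₀ + b * f₀ + p₀) + (a * b * n + a * g₁ + b * f₁ + p₁) ≡
    a * b * (n + (n + 0ℤ)) + a * (g₀ + g₁) + b * (f₀ + f₁) + (p₀ + p₁)
  lem = solve-∀

∑V-shift : (a : ℤ) (f : Vec Bool d → ℤ) → ∑V (λ w → a + f w) ≡ a * 2^ d + ∑V f
∑V-shift {zero}  a f = cong (_+ f []) (sym (ℤ.*-identityʳ a))
∑V-shift {suc d} a f = trans (cong₂ _+_ (∑V-shift a (f ∘ (false ∷_))) (∑V-shift a (f ∘ (true ∷_))))
  (lem a (2^ d) (∑V (f ∘ (false ∷_))) (∑V (f ∘ (true ∷_))))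
  where
  lem : ∀ a n f g → (a * n + f) + (a * n + g) ≡ a * (n + (n + 0ℤ)) + (f + g)
  lem = solve-∀

-- The mean distance from any word is d/2.
∑V-ham : (u : Vec Bool d) → ℤ+ 2 * ∑V (H u) ≡ ℤ+ d * 2^ d
∑V-ham []                = refl
∑V-ham {suc d} (x ∷ u) = trans
  (cong (ℤ+ 2 *_) (cong₂ _+_ (∑V-shift (ℤ+ b2n (x xor false)) (H u)) (∑V-shift (ℤ+ b2n (x xor true)) (H u))))
  (cases x)
  where
  lem : ∀ n s d → s ≡ d * n → s + s + ℤ+ 2 * n ≡ (1ℤ + d) * (n + (n + 0ℤ))
  lem n s d refl = lem′ n d
    where
    lem′ : ∀ n d → d * n + d * n + ℤ+ 2 * n ≡ (1ℤ + d) * (n + (n + 0ℤ))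
    lem′ = solve-∀
  false-case : ∀ n s → ℤ+ 2 * ((0ℤ * n + s) + (1ℤ * n + s)) ≡ ℤ+ 2 * s + ℤ+ 2 * s + ℤ+ 2 * n
  false-case = solve-∀
  true-case : ∀ n s → ℤ+ 2 * ((1ℤ * n + s) + (0ℤ * n + s)) ≡ ℤ+ 2 * s + ℤ+ 2 * s + ℤ+ 2 * n
  true-case = solve-∀
  cases : ∀ x → ℤ+ 2 * ((ℤ+ b2n (x xor false) * 2^ d + ∑V (H u)) + (ℤ+ b2n (x xor true) * 2^ d + ∑V (H u))) ≡
    ℤ+ suc d * 2^ (suc d)
  cases false = trans (false-case (2^ d) (∑V (H u))) (lem (2^ d) (ℤ+ 2 * ∑V (H u)) (ℤ+ d) (∑V-ham u))
  cases true  = trans (true-case (2^ d) (∑V (H u))) (lem (2^ d) (ℤ+ 2 * ∑V (H u)) (ℤ+ d) (∑V-ham u))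

-- Induction on d, splitting the sum by the first letter of w. Equal first letters of the two words
-- produce the term 4N through the shift product 1·1; different ones produce the same 4N through the
-- additional 1 in their distance. This balance fixes the ratio of the coefficients 4 and 2N.
∑V-ham-ham : (u v : Vec Bool d) →
  ℤ+ 4 * ∑V (λ w → H u w * H w v) + ℤ+ 2 * 2^ d * H u v ≡ ℤ+ d * ℤ+ suc d * 2^ d
∑V-ham-ham [] [] = refl
∑V-ham-ham {suc d} (x ∷ u) (y ∷ v) = trans
  (cong (λ s → ℤ+ 4 * s + ℤ+ 2 * 2^ (suc d) * H (x ∷ u) (y ∷ v)) (cong₂ _+_
    (∑V-affine (ℤ+ b2n (x xor false)) (ℤ+ b2n (false xor y)) (H u) (λ w → H w v))
    (∑V-affine (ℤ+ b2n (x xor true)) (ℤ+ b2n (true xor y)) (H u) (λ w → H w v))))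
  (trans (cases x y) total)
  where
  N f g p h : ℤ
  N = 2^ d
  f = ∑V (H u)
  g = ∑V (λ w → H w v)
  p = ∑V (λ w → H u w * H w v)
  h = H u v
  affine : ℤ → ℤ → ℤ
  affine a b = a * b * N + a * g + b * f + p
  same : ∀ n f g p h → ℤ+ 4 * ((0ℤ * 0ℤ * n + 0ℤ * g + 0ℤ * f + p) + (1ℤ * 1ℤ * n + 1ℤ * g + 1ℤ * f + p)) +
      ℤ+ 2 * (n + (n + 0ℤ)) * h ≡
    ℤ+ 2 * (ℤ+ 4 * p + ℤ+ 2 * n * h) + ℤ+ 2 * (ℤ+ 2 * f) + ℤ+ 2 * (ℤ+ 2 * g) + ℤ+ 4 * n
  same = solve-∀
  opposite : ∀ n f g p h → ℤ+ 4 * ((0ℤ * 1ℤ * n + 0ℤ * g + 1ℤ * f + p) + (1ℤ * 0ℤ * n + 1ℤ * g + 0ℤ * f + p)) +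
      ℤ+ 2 * (n + (n + 0ℤ)) * (1ℤ + h) ≡
    ℤ+ 2 * (ℤ+ 4 * p + ℤ+ 2 * n * h) + ℤ+ 2 * (ℤ+ 2 * f) + ℤ+ 2 * (ℤ+ 2 * g) + ℤ+ 4 * n
  opposite = solve-∀
  final : ∀ n d → ℤ+ 2 * (d * (1ℤ + d) * n) + ℤ+ 2 * (d * n) + ℤ+ 2 * (d * n) + ℤ+ 4 * n ≡
    (1ℤ + d) * (ℤ+ 2 + d) * (n + (n + 0ℤ))
  final = solve-∀
  cases : ∀ x y → ℤ+ 4 * (affine (ℤ+ b2n (x xor false)) (ℤ+ b2n (false xor y)) +
      affine (ℤ+ b2n (x xor true)) (ℤ+ b2n (true xor y))) + ℤ+ 2 * 2^ (suc d) * H (x ∷ u) (y ∷ v) ≡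
    ℤ+ 2 * (ℤ+ 4 * p + ℤ+ 2 * N * h) + ℤ+ 2 * (ℤ+ 2 * f) + ℤ+ 2 * (ℤ+ 2 * g) + ℤ+ 4 * N
  cases false false = same N f g p h
  cases true  true  = trans
    (cong (λ s → ℤ+ 4 * s + ℤ+ 2 * 2^ (suc d) * h) (ℤ.+-comm (affine 1ℤ 1ℤ) (affine 0ℤ 0ℤ))) (same N f g p h)
  cases false true  = opposite N f g p h
  cases true  false = trans
    (cong (λ s → ℤ+ 4 * s + ℤ+ 2 * 2^ (suc d) * (1ℤ + h)) (ℤ.+-comm (affine 1ℤ 0ℤ) (affine 0ℤ 1ℤ)))
    (opposite N f g p h)
  total : ℤ+ 2 * (ℤ+ 4 * p + ℤ+ 2 * N * h) + ℤ+ 2 * (ℤ+ 2 * f) + ℤ+ 2 * (ℤ+ 2 * g) + ℤ+ 4 * N ≡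
    ℤ+ suc d * ℤ+ suc (suc d) * 2^ (suc d)
  total = trans
    (cong₂ (λ a b → a + b + ℤ+ 4 * N)
      (cong₂ (λ a b → ℤ+ 2 * a + ℤ+ 2 * b) (∑V-ham-ham u v) (∑V-ham u))
      (cong (ℤ+ 2 *_) (trans (cong (ℤ+ 2 *_) (∑V-cong (λ w → cong ℤ+_ (ham-sym w v)))) (∑V-ham v))))
    (final N (ℤ+ d))

distanceMatrix : (Fin n → Fin n → ℕ) → Matrix n
distanceMatrix D i j = ℤ+ D i j

cube-quad : ∀ {DQ} → IsDistanceMatrix (Cube d) DQ → ∀ i j →
  quad (ℤ+ 2 * 2^ d) (distanceMatrix DQ) i j ≡ ℤ+ d * ℤ+ suc d * 2^ d
cube-quad {d} {DQ} isD i j with u , refl ← enc-surjective d i | v , refl ← enc-surjective d j = trans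
  (cong₂ (λ a b → ℤ+ 4 * a + ℤ+ 2 * 2^ d * b)
    (trans (∑-enc d (λ k → ℤ+ DQ (enc u) k * ℤ+ DQ k (enc v)))
      (∑V-cong (λ w → cong₂ (λ a b → ℤ+ a * ℤ+ b) (cube-distance d isD u w) (cube-distance d isD w v))))
    (cong ℤ+_ (cube-distance d isD u v)))
  (∑V-ham-ham u v)

-- Graph distances

walk-snoc : {G : Graph n} {x y z : Fin n} {k : ℕ} → Walk G x y k → T (adj G y z) → Walk G x z (suc k)
walk-snoc here       a = step a here
walk-snoc (step b w) a = step b (walk-snoc w a)

walk-reverse : {G : Graph n} {x y : Fin n} {k : ℕ} → Walk G x y k → Walk G y x k
walk-reverse here = here
walk-reverse {G = G} (step {x} {y} a w) = walk-snoc (walk-reverse w) (subst T (adj-sym G x y) a)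

module Distance {n : ℕ} (G : Graph n) {D : Fin n → Fin n → ℕ} (isD : IsDistanceMatrix G D) where

  D-sym : ∀ x y → D x y ≡ D y x
  D-sym x y = ℕ.≤-antisym
    (proj₂ (isD x y) (D y x) (walk-reverse (proj₁ (isD y x))))
    (proj₂ (isD y x) (D x y) (walk-reverse (proj₁ (isD x y))))

  A-sym : ∀ x y → distanceMatrix D x y ≡ distanceMatrix D y x
  A-sym x y = cong ℤ+_ (D-sym x y)

  D-refl : ∀ x → D x x ≡ 0
  D-refl x = ℕ.n≤0⇒n≡0 (proj₂ (isD x x) 0 here)

  D≡0⇒≡ : ∀ x y → D x y ≡ 0 → x ≡ y
  D≡0⇒≡ x y eq with D x y | proj₁ (isD x y)
  D≡0⇒≡ x y refl | .0 | here = refl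

  D-lipschitz : ∀ {x y} z → T (adj G x y) → D x z ℕ.≤ suc (D y z)
  D-lipschitz {x} {y} z a = proj₂ (isD x z) (suc (D y z)) (step a (proj₁ (isD y z)))

  adj⇒D≡1 : ∀ {x y} → T (adj G x y) → D x y ≡ 1
  adj⇒D≡1 {x} {y} a with D x y in eq | proj₂ (isD x y) 1 (step a here)
  ... | 0 | _ with refl ← D≡0⇒≡ x y eq = contradiction (subst T (irrefl G x) a) λ ()
  ... | 1 | _ = refl
  ... | suc (suc _) | ℕ.s≤s ()

  D≡1⇒adj : ∀ {x y} → D x y ≡ 1 → T (adj G x y)
  D≡1⇒adj {x} {y} eq with D x y | proj₁ (isD x y)
  D≡1⇒adj refl | .1 | step a here = a

  adj≡ : ∀ x y → adj G x y ≡ (D x y ≡ᵇ 1)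
  adj≡ x y = T-injective (λ a → ℕ.≡⇒≡ᵇ (D x y) 1 (adj⇒D≡1 a)) (λ e → D≡1⇒adj (ℕ.≡ᵇ⇒≡ (D x y) 1 e))
    where
    T-injective : ∀ {a b} → (T a → T b) → (T b → T a) → a ≡ b
    T-injective {true}  {true}  f g = refl
    T-injective {false} {false} f g = refl
    T-injective {true}  {false} f g = contradiction (f tt) λ ()
    T-injective {false} {true}  f g = contradiction (g tt) λ ()

-- From rank one to a constant matrix

close⇒square≤1 : ∀ a b → a ℕ.≤ suc b → b ℕ.≤ suc a → (ℤ+ a - ℤ+ b) * (ℤ+ a - ℤ+ b) ≤ 1ℤ
close⇒square≤1 a b a≤ b≤ with ℕ.<-cmp a b
... | tri≈ _ refl _ = subst (λ x → x * x ≤ 1ℤ) (sym (ℤ.+-inverseʳ (ℤ+ a))) (ℤ.+≤+ ℕ.z≤n)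
... | tri< a<b _ _ with refl ← ℕ.≤-antisym b≤ a<b = ℤ.≤-reflexive (lem (ℤ+ a))
  where
  lem : ∀ a → (a - (1ℤ + a)) * (a - (1ℤ + a)) ≡ 1ℤ
  lem = solve-∀
... | tri> _ _ b<a with refl ← ℕ.≤-antisym a≤ b<a = ℤ.≤-reflexive (lem (ℤ+ b))
  where
  lem : ∀ b → (1ℤ + b - b) * (1ℤ + b - b) ≡ 1ℤ
  lem = solve-∀

∑-mono-≤ : {f g : Fin n → ℤ} → (∀ i → f i ≤ g i) → sumFin f ≤ sumFin g
∑-mono-≤ {zero}  le = ℤ.≤-refl
∑-mono-≤ {suc n} le = ℤ.+-mono-≤ (le zero) (∑-mono-≤ (le ∘ suc))

-- The equality case of the inequality between arithmetic and geometric mean, without roots: for e =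
-- 2r - (p + q) ≥ 0 one has (p - q)² + 2(p + q)e + e² = 4r² - 4pq = 0.
amgm-equality : ∀ {p q r} → 0ℤ ≤ p → 0ℤ ≤ q → p + q ≤ ℤ+ 2 * r → p * q ≡ r * r → p ≡ q
amgm-equality {p} {q} {r} p≥0 q≥0 le eq = ℤ.i-j≡0⇒i≡j p q (i*i≡0⇒i≡0 (p - q)
  (proj₁ (0≤+⇒≡0 (0≤i*i (p - q)) (ℤ.+-mono-≤ (0≤i*j (ℤ.+-mono-≤ p≥0 q≥0) e≥0) (0≤i*i e))
    (trans (lem p q r) (trans (cong (λ x → ℤ+ 4 * (r * r) - ℤ+ 4 * x) eq) (ℤ.+-inverseʳ (ℤ+ 4 * (r * r))))))))
  where
  e = ℤ+ 2 * r - (p + q)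
  e≥0 : 0ℤ ≤ e
  e≥0 = ℤ.i≤j⇒0≤j-i le
  0≤i*j : ∀ {i j} → 0ℤ ≤ i → 0ℤ ≤ j → 0ℤ ≤ ℤ+ 2 * i * j
  0≤i*j {ℤ+ a} {ℤ+ b} _ _ = subst (0ℤ ≤_) (trans (ℤ.pos-* (2 ℕ.* a) b) (cong (_* ℤ+ b) (ℤ.pos-* 2 a))) (ℤ.+≤+ ℕ.z≤n)
  lem : ∀ p q r → (p - q) * (p - q) + (ℤ+ 2 * (p + q) * (ℤ+ 2 * r - (p + q)) +
      (ℤ+ 2 * r - (p + q)) * (ℤ+ 2 * r - (p + q))) ≡ ℤ+ 4 * (r * r) - ℤ+ 4 * (p * q)
  lem = solve-∀

square-equality : ∀ {p r} → 0ℤ ≤ p → 0ℤ ≤ r → p * p ≡ r * r → r ≡ p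
square-equality {ℤ+ p} {ℤ+ r} _ _ eq with ℕ.<-cmp p r
... | tri≈ _ refl _ = refl
... | tri< p<r _ _ = contradiction (ℤ.+-injective eqℕ) (ℕ.<⇒≢ (ℕ.*-mono-< p<r p<r))
  where eqℕ = trans (ℤ.pos-* p p) (trans eq (sym (ℤ.pos-* r r)))
... | tri> _ _ r<p = contradiction (ℤ.+-injective eqℕ) (ℕ.>⇒≢ (ℕ.*-mono-< r<p r<p))
  where eqℕ = trans (ℤ.pos-* p p) (trans eq (sym (ℤ.pos-* r r)))

module _ {n : ℕ} (G : Graph n) {D : Fin n → Fin n → ℕ} (isD : IsDistanceMatrix G D) where
  open Distance G isD
  private
    A M : Matrix n
    A = distanceMatrix D
    M = quad (ℤ+ 2 * ℤ+ n) A

  M-sym : ∀ x y → M x y ≡ M y x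
  M-sym x y = cong₂ (λ a b → ℤ+ 4 * a + ℤ+ 2 * ℤ+ n * b)
    (∑-cong (λ k → trans (ℤ.*-comm (A x k) (A k y)) (cong₂ _*_ (A-sym k y) (A-sym x k)))) (A-sym x y)

  0≤M : ∀ x y → 0ℤ ≤ M x y
  0≤M x y = ℤ.+-mono-≤
    (0≤ (∑-nonneg (λ k → 0≤* (D x k) (D k y))))
    (subst (0ℤ ≤_) (trans (ℤ.pos-* (2 ℕ.* n) (D x y)) (cong (_* A x y) (ℤ.pos-* 2 n))) (ℤ.+≤+ ℕ.z≤n))
    where
    0≤* : ∀ a b → 0ℤ ≤ ℤ+ a * ℤ+ b
    0≤* a b = subst (0ℤ ≤_) (ℤ.pos-* a b) (ℤ.+≤+ ℕ.z≤n)
    0≤ : ∀ {i} → 0ℤ ≤ i → 0ℤ ≤ ℤ+ 4 * i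
    0≤ {ℤ+ a} _ = 0≤* 4 a

  -- Expand the square and substitute 4A² = M - 2nA; the diagonal of A is zero.
  rowDifference : ∀ x y → ℤ+ 4 * sumFin (λ z → (A x z - A y z) * (A x z - A y z)) ≡
    M x x + M y y - ℤ+ 2 * M x y + ℤ+ 4 * ℤ+ n * A x y
  rowDifference x y = begin
    ℤ+ 4 * sumFin (λ z → (A x z - A y z) * (A x z - A y z))
      ≡⟨ cong (ℤ+ 4 *_) (∑-cong (λ z → trans (square (A x z) (A y z))
           (cong₂ (λ a b → A x z * a + (A y z * b + - ℤ+ 2 * (A x z * b))) (A-sym x z) (A-sym y z)))) ⟩
    ℤ+ 4 * sumFin (λ z → A x z * A z x + (A y z * A z y + - ℤ+ 2 * (A x z * A z y)))
      ≡⟨ cong (ℤ+ 4 *_) (∑-linear₃ (- ℤ+ 2) (λ z → A x z * A z x) (λ z → A y z * A z y) (λ z → A x z * A z y)) ⟩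
    ℤ+ 4 * ((A ⊗ A) x x + ((A ⊗ A) y y + - ℤ+ 2 * (A ⊗ A) x y))
      ≡⟨ expand ((A ⊗ A) x x) ((A ⊗ A) y y) ((A ⊗ A) x y) (ℤ+ n) (A x y) ⟩
    (ℤ+ 4 * (A ⊗ A) x x + ℤ+ 2 * ℤ+ n * 0ℤ) + (ℤ+ 4 * (A ⊗ A) y y + ℤ+ 2 * ℤ+ n * 0ℤ) -
      ℤ+ 2 * M x y + ℤ+ 4 * ℤ+ n * A x y
      ≡⟨ cong₂ (λ a b → (ℤ+ 4 * (A ⊗ A) x x + ℤ+ 2 * ℤ+ n * a) + (ℤ+ 4 * (A ⊗ A) y y + ℤ+ 2 * ℤ+ n * b) -
           ℤ+ 2 * M x y + ℤ+ 4 * ℤ+ n * A x y) (cong ℤ+_ (D-refl x)) (cong ℤ+_ (D-refl y)) ⟨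
    M x x + M y y - ℤ+ 2 * M x y + ℤ+ 4 * ℤ+ n * A x y ∎
    where
    open ≡-Reasoning
    square : ∀ a b → (a - b) * (a - b) ≡ a * a + (b * b + - ℤ+ 2 * (a * b))
    square = solve-∀
    expand : ∀ p q r n a → ℤ+ 4 * (p + (q + - ℤ+ 2 * r)) ≡
      (ℤ+ 4 * p + ℤ+ 2 * n * 0ℤ) + (ℤ+ 4 * q + ℤ+ 2 * n * 0ℤ) - ℤ+ 2 * (ℤ+ 4 * r + ℤ+ 2 * n * a) + ℤ+ 4 * n * a
    expand = solve-∀

  -- For adjacent vertices the left side of `rowDifference` is at most 4n, and the last term on its
  -- right is exactly 4n. Hence M x x + M y y ≤ 2 M x y, the reverse of the inequality of means that
  -- rank one implies, so equality holds.
  adjacent-diagonal : (∀ x y → M x x * M y y ≡ M x y * M x y) → ∀ {x y} → T (adj G x y) → M x x ≡ M y y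
  adjacent-diagonal rank1 {x} {y} a = amgm-equality (0≤M x x) (0≤M y y) bound (rank1 x y)
    where
    lem : ∀ p q r n → p + q - ℤ+ 2 * r + ℤ+ 4 * n * 1ℤ + (ℤ+ 2 * r - ℤ+ 4 * n) ≡ p + q
    lem = solve-∀
    lem′ : ∀ r n → ℤ+ 4 * n + (ℤ+ 2 * r - ℤ+ 4 * n) ≡ ℤ+ 2 * r
    lem′ = solve-∀
    sum-bound : sumFin (λ z → (A x z - A y z) * (A x z - A y z)) ≤ ℤ+ n
    sum-bound = subst (sumFin (λ z → (A x z - A y z) * (A x z - A y z)) ≤_)
      (trans (∑-const {n} 1ℤ) (ℤ.*-identityʳ (ℤ+ n)))
      (∑-mono-≤ (λ z → close⇒square≤1 (D x z) (D y z) (D-lipschitz z a)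
        (D-lipschitz z (subst T (adj-sym G x y) a))))
    bound : M x x + M y y ≤ ℤ+ 2 * M x y
    bound = subst₂ _≤_
      (trans (cong (_+ (ℤ+ 2 * M x y - ℤ+ 4 * ℤ+ n)) (trans (rowDifference x y)
          (cong (λ k → M x x + M y y - ℤ+ 2 * M x y + ℤ+ 4 * ℤ+ n * ℤ+ k) (adj⇒D≡1 a))))
        (lem (M x x) (M y y) (M x y) (ℤ+ n)))
      (lem′ (M x y) (ℤ+ n))
      (ℤ.+-monoˡ-≤ (ℤ+ 2 * M x y - ℤ+ 4 * ℤ+ n) (ℤ.*-monoˡ-≤-nonNeg (ℤ+ 4) sum-bound))

  -- The diagonal is constant along walks, so rank one reads (M x x)² = (M x y)², and both entries
  -- are nonnegative.
  rank1⇒constant : Connected G → (∀ x y → M x x * M y y ≡ M x y * M x y) → ∀ x y → M x y ≡ M x x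
  rank1⇒constant connected rank1 x y = square-equality (0≤M x x) (0≤M x y)
    (trans (cong (M x x *_) (along (proj₂ (connected x y)))) (rank1 x y))
    where
    along : ∀ {x y k} → Walk G x y k → M x x ≡ M y y
    along here = refl
    along (step a w) = trans (adjacent-diagonal rank1 a) (along w)

-- Sums over lists and maximal families

∑L : (Item → ℤ) → List Item → ℤ
∑L f []      = 0ℤ
∑L f (x ∷ L) = f x + ∑L f L

∑L-cong : {f g : Item → ℤ} {L : List Item} → All (λ x → f x ≡ g x) L → ∑L f L ≡ ∑L g L
∑L-cong []         = refl
∑L-cong (eq ∷ eqs) = cong₂ _+_ eq (∑L-cong eqs)

∑L-zero : {f : Item → ℤ} {L : List Item} → All (λ x → f x ≡ 0ℤ) L → ∑L f L ≡ 0ℤ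
∑L-zero []         = refl
∑L-zero (eq ∷ eqs) = cong₂ _+_ eq (∑L-zero eqs)

∑L-+ : (f g : Item → ℤ) (L : List Item) → ∑L (λ x → f x + g x) L ≡ ∑L f L + ∑L g L
∑L-+ f g []      = refl
∑L-+ f g (x ∷ L) = trans (cong (f x + g x +_) (∑L-+ f g L)) (lem (f x) (g x) (∑L f L) (∑L g L))
  where
  lem : ∀ a b c e → a + b + (c + e) ≡ a + c + (b + e)
  lem = solve-∀

∑L-const : (c : ℤ) (L : List Item) → ∑L (λ _ → c) L ≡ ℤ+ length L * c
∑L-const c []      = sym (ℤ.*-zeroˡ c)
∑L-const c (x ∷ L) = trans (cong (c +_) (∑L-const c L)) (sym (ℤ.suc-* (ℤ+ length L) c))

∑-∑L : (f : Item → Fin n → ℤ) (L : List Item) → sumFin (λ i → ∑L (λ x → f x i) L) ≡ ∑L (λ x → sumFin (f x)) L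
∑-∑L {n = n} f []      = ∑-zero {n} (λ _ → refl)
∑-∑L f (x ∷ L) = trans (∑-distrib-+ (f x) (λ i → ∑L (λ x → f x i) L)) (cong (sumFin (f x) +_) (∑-∑L f L))

-- Greedy choice: an item satisfying E is added unless it is P-related to a chosen one, and the
-- dichotomy then makes it R-related to all of them.
maximal : {E : Item → Set} {R P : Item → Item → Set} → (∀ x → Dec (E x)) → (∀ {x} → P x x) →
  (∀ {x y} → E x → E y → R x y ⊎ P x y) → (xs : List Item) →
  ∃ λ L → All E L × AllPairs R L × All (λ x → E x → Any (P x) L) xs
maximal E? P-refl dichotomy [] = [] , [] , [] , []
maximal {Item} {E} {R} {P} E? P-refl dichotomy (x ∷ xs)
  with L , EL , RL , PL ← maximal {E = E} {R} {P} E? P-refl dichotomy xs | E? x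
... | no ¬Ex = L , EL , RL , (λ Ex → contradiction Ex ¬Ex) ∷ PL
... | yes Ex with split EL
  where
  split : ∀ {L} → All E L → All (R x) L ⊎ Any (P x) L
  split [] = inj₁ []
  split (Ey ∷ EL) with dichotomy Ex Ey | split EL
  ... | inj₂ p | _      = inj₂ (here p)
  ... | inj₁ _ | inj₂ q = inj₂ (there q)
  ... | inj₁ r | inj₁ s = inj₁ (r ∷ s)
...   | inj₁ r = x ∷ L , Ex ∷ EL , r ∷ RL , (λ _ → here P-refl) ∷ All.map (λ f Ey → there (f Ey)) PL
...   | inj₂ p = L , EL , RL , (λ _ → p) ∷ PL

-- The isometric embedding into a cube and its dimension

module Embedding {n : ℕ} (G : Graph n) {D : Fin n → Fin n → ℕ} (isD : IsDistanceMatrix G D)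
  (connected : Connected G) (0<n : 0 ℕ.< n) (b : ℤ)
  (constant : ∀ x y → quad (ℤ+ 2 * ℤ+ n) (distanceMatrix D) x y ≡ b) where

  open Distance G isD

  private instance
    n≢0 : ℤ.NonZero (ℤ+ n)
    n≢0 = ℤ.≢-nonZero (λ eq → ℕ.<⇒≢ 0<n (sym (ℤ.+-injective eq)))

  A M : Matrix n
  A = distanceMatrix D
  M = quad (ℤ+ 2 * ℤ+ n) A

  A-refl : ∀ x → A x x ≡ 0ℤ
  A-refl x = cong ℤ+_ (D-refl x)

  Pair : Set
  Pair = Fin n × Fin n

  IsEdge : Pair → Set
  IsEdge (x , y) = T (adj G x y)

  s : Pair → Fin n → ℤ
  s (x , y) u = A x u - A y u

  ⟨_,_⟩ : Pair → Pair → ℤ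
  ⟨ e , f ⟩ = sumFin (λ u → s e u * s f u)

  -- Since 4A² = bJ - 2nA and a double difference annihilates J, inner products of row differences
  -- are read off from four entries of A. The geometry of the vectors `s e` rests on this formula.
  inner-product : ∀ e z w → ℤ+ 2 * ⟨ e , (z , w) ⟩ ≡ ℤ+ n * (s e w - s e z)
  inner-product e@(x , y) z w = ℤ.*-cancelˡ-≡ (ℤ+ 2) (ℤ+ 2 * ⟨ e , (z , w) ⟩) (ℤ+ n * (s e w - s e z)) (begin
    ℤ+ 2 * (ℤ+ 2 * ⟨ e , (z , w) ⟩)
      ≡⟨ cong (λ p → ℤ+ 2 * (ℤ+ 2 * p)) inner ⟩
    ℤ+ 2 * (ℤ+ 2 * ((A ⊗ A) x z + - 1ℤ * (A ⊗ A) x w + - 1ℤ * ((A ⊗ A) y z + - 1ℤ * (A ⊗ A) y w)))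
      ≡⟨ regroup ((A ⊗ A) x z) ((A ⊗ A) x w) ((A ⊗ A) y z) ((A ⊗ A) y w) (A x z) (A x w) (A y z) (A y w) (ℤ+ n) ⟩
    (M x z - M x w - (M y z - M y w)) + ℤ+ 2 * (ℤ+ n * (s e w - s e z))
      ≡⟨ cong (_+ ℤ+ 2 * (ℤ+ n * (s e w - s e z))) (cong₂ (λ p q → p - q)
           (trans (cong₂ _-_ (constant x z) (constant x w)) (ℤ.+-inverseʳ b))
           (trans (cong₂ _-_ (constant y z) (constant y w)) (ℤ.+-inverseʳ b))) ⟩
    0ℤ - 0ℤ + ℤ+ 2 * (ℤ+ n * (s e w - s e z))
      ≡⟨ ℤ.+-identityˡ (ℤ+ 2 * (ℤ+ n * (s e w - s e z))) ⟩
    ℤ+ 2 * (ℤ+ n * (s e w - s e z)) ∎)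
    where
    open ≡-Reasoning
    product : ∀ a b c e → (a - b) * (c - e) ≡ a * c + - 1ℤ * (a * e) + - 1ℤ * (b * c + - 1ℤ * (b * e))
    product = solve-∀
    inner : ⟨ e , (z , w) ⟩ ≡ (A ⊗ A) x z + - 1ℤ * (A ⊗ A) x w + - 1ℤ * ((A ⊗ A) y z + - 1ℤ * (A ⊗ A) y w)
    inner = begin
      ⟨ e , (z , w) ⟩
        ≡⟨ ∑-cong (λ u → trans (cong₂ (λ p q → (A x u - A y u) * (p - q)) (A-sym z u) (A-sym w u))
             (product (A x u) (A y u) (A u z) (A u w))) ⟩
      sumFin (λ u → A x u * A u z + - 1ℤ * (A x u * A u w) + - 1ℤ * (A y u * A u z + - 1ℤ * (A y u * A u w)))
        ≡⟨ ∑-linear (- 1ℤ) (λ u → A x u * A u z + - 1ℤ * (A x u * A u w))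
             (λ u → A y u * A u z + - 1ℤ * (A y u * A u w)) ⟩
      sumFin (λ u → A x u * A u z + - 1ℤ * (A x u * A u w)) +
        - 1ℤ * sumFin (λ u → A y u * A u z + - 1ℤ * (A y u * A u w))
        ≡⟨ cong₂ (λ p q → p + - 1ℤ * q) (∑-linear (- 1ℤ) (λ u → A x u * A u z) (λ u → A x u * A u w))
             (∑-linear (- 1ℤ) (λ u → A y u * A u z) (λ u → A y u * A u w)) ⟩
      (A ⊗ A) x z + - 1ℤ * (A ⊗ A) x w + - 1ℤ * ((A ⊗ A) y z + - 1ℤ * (A ⊗ A) y w) ∎
    regroup : ∀ p q r t a c e f k → ℤ+ 2 * (ℤ+ 2 * (p + - 1ℤ * q + - 1ℤ * (r + - 1ℤ * t))) ≡
      ((ℤ+ 4 * p + ℤ+ 2 * k * a) - (ℤ+ 4 * q + ℤ+ 2 * k * c) - ((ℤ+ 4 * r + ℤ+ 2 * k * e) - (ℤ+ 4 * t + ℤ+ 2 * k * f))) +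
      ℤ+ 2 * (k * ((c - f) - (a - e)))
    regroup = solve-∀

  inner-comm : ∀ e f → ⟨ e , f ⟩ ≡ ⟨ f , e ⟩
  inner-comm e f = ∑-cong (λ u → ℤ.*-comm (s e u) (s f u))

  edge-ends : ∀ {x y} → T (adj G x y) → s (x , y) x ≡ - 1ℤ × s (x , y) y ≡ 1ℤ
  edge-ends {x} {y} a = cong₂ _-_ (A-refl x) (cong ℤ+_ (trans (D-sym y x) (adj⇒D≡1 a))) ,
    cong₂ _-_ (cong ℤ+_ (adj⇒D≡1 a)) (A-refl y)

  edge-norm : ∀ {e} → IsEdge e → ⟨ e , e ⟩ ≡ ℤ+ n
  edge-norm {x , y} a = ℤ.*-cancelˡ-≡ (ℤ+ 2) ⟨ (x , y) , (x , y) ⟩ (ℤ+ n) (trans (inner-product (x , y) x y)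
    (trans (cong₂ (λ p q → ℤ+ n * (p - q)) (proj₂ (edge-ends a)) (proj₁ (edge-ends a))) (ℤ.*-comm (ℤ+ n) (ℤ+ 2))))

  ∑1 : sumFin {n} (λ _ → 1ℤ) ≡ ℤ+ n
  ∑1 = trans (∑-const {n} 1ℤ) (ℤ.*-identityʳ (ℤ+ n))

  -- The n squares are at most 1 each and add up to n.
  edge-square : ∀ {e} → IsEdge e → ∀ u → s e u * s e u ≡ 1ℤ
  edge-square {e@(x , y)} a u = sym (ℤ.i-j≡0⇒i≡j 1ℤ (s e u * s e u)
    (trans (lem (s e u * s e u)) (∑-nonneg-zero {f = λ u → 1ℤ + - 1ℤ * (s e u * s e u)} nonneg
      (trans (∑-linear (- 1ℤ) (λ _ → 1ℤ) (λ u → s e u * s e u))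
        (trans (cong₂ (λ p q → p + - 1ℤ * q) ∑1 (edge-norm a)) (cancel (ℤ+ n)))) u)))
    where
    lem : ∀ q → 1ℤ - q ≡ 1ℤ + - 1ℤ * q
    lem = solve-∀
    cancel : ∀ k → k + - 1ℤ * k ≡ 0ℤ
    cancel = solve-∀
    nonneg : ∀ u → 0ℤ ≤ 1ℤ + - 1ℤ * (s e u * s e u)
    nonneg u = subst (0ℤ ≤_) (lem (s e u * s e u)) (ℤ.i≤j⇒0≤j-i (close⇒square≤1 (D x u) (D y u)
      (D-lipschitz u a) (D-lipschitz u (subst T (adj-sym G x y) a))))

  Parallel : Pair → Pair → Set
  Parallel e f = ∃ λ σ → σ * σ ≡ 1ℤ × (∀ u → s e u ≡ σ * s f u)

  Orthogonal : Pair → Pair → Set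
  Orthogonal e f = ⟨ e , f ⟩ ≡ 0ℤ

  parallel-refl : ∀ {e} → Parallel e e
  parallel-refl {e} = 1ℤ , refl , λ u → sym (ℤ.*-identityˡ (s e u))

  sign-cases : ∀ {p} → p * p ≡ 1ℤ → p ≡ 1ℤ ⊎ p ≡ - 1ℤ
  sign-cases {p} eq with ℤ.i*j≡0⇒i≡0∨j≡0 (p - 1ℤ) (trans (lem p) (ℤ.i≡j⇒i-j≡0 eq))
    where
    lem : ∀ p → (p - 1ℤ) * (p - - 1ℤ) ≡ p * p - 1ℤ
    lem = solve-∀
  ... | inj₁ q = inj₁ (ℤ.i-j≡0⇒i≡j p 1ℤ q)
  ... | inj₂ q = inj₂ (ℤ.i-j≡0⇒i≡j p (- 1ℤ) q)

  -- Equality in the Cauchy–Schwarz inequality.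
  parallel-from-product : ∀ {e f} → IsEdge e → IsEdge f → ∀ σ → σ * σ ≡ 1ℤ → ⟨ e , f ⟩ ≡ σ * ℤ+ n → Parallel e f
  parallel-from-product {e} {f} Ee Ef σ σ² eq = σ , σ² , λ u → ℤ.i-j≡0⇒i≡j (s e u) (σ * s f u)
    (i*i≡0⇒i≡0 (s e u - σ * s f u) (∑-nonneg-zero {f = λ u → (s e u - σ * s f u) * (s e u - σ * s f u)}
      (λ u → 0≤i*i (s e u - σ * s f u)) total u))
    where
    open ≡-Reasoning
    square : ∀ a c k → (a - k * c) * (a - k * c) ≡ a * a + k * k * (c * c) + - ℤ+ 2 * k * (a * c)
    square = solve-∀
    cancel : ∀ k σ → k + 1ℤ * k + - ℤ+ 2 * σ * (σ * k) ≡ ℤ+ 2 * k * (1ℤ - σ * σ)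
    cancel = solve-∀
    total : sumFin (λ u → (s e u - σ * s f u) * (s e u - σ * s f u)) ≡ 0ℤ
    total = begin
      sumFin (λ u → (s e u - σ * s f u) * (s e u - σ * s f u))
        ≡⟨ ∑-cong (λ u → square (s e u) (s f u) σ) ⟩
      sumFin (λ u → s e u * s e u + σ * σ * (s f u * s f u) + - ℤ+ 2 * σ * (s e u * s f u))
        ≡⟨ ∑-linear (- ℤ+ 2 * σ) (λ u → s e u * s e u + σ * σ * (s f u * s f u)) (λ u → s e u * s f u) ⟩
      sumFin (λ u → s e u * s e u + σ * σ * (s f u * s f u)) + - ℤ+ 2 * σ * ⟨ e , f ⟩
        ≡⟨ cong (_+ - ℤ+ 2 * σ * ⟨ e , f ⟩) (∑-linear (σ * σ) (λ u → s e u * s e u) (λ u → s f u * s f u)) ⟩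
      ⟨ e , e ⟩ + σ * σ * ⟨ f , f ⟩ + - ℤ+ 2 * σ * ⟨ e , f ⟩
        ≡⟨ cong₂ (λ p q → p + - ℤ+ 2 * σ * q)
             (cong₂ _+_ (edge-norm Ee) (cong₂ _*_ σ² (edge-norm Ef))) eq ⟩
      ℤ+ n + 1ℤ * ℤ+ n + - ℤ+ 2 * σ * (σ * ℤ+ n)
        ≡⟨ cancel (ℤ+ n) σ ⟩
      ℤ+ 2 * ℤ+ n * (1ℤ - σ * σ)
        ≡⟨ cong (λ q → ℤ+ 2 * ℤ+ n * (1ℤ - q)) σ² ⟩
      ℤ+ 2 * ℤ+ n * 0ℤ
        ≡⟨ ℤ.*-zeroʳ (ℤ+ 2 * ℤ+ n) ⟩
      0ℤ ∎

  -- The values at z and w are signs, so the inner product is 0, n or -n; the extreme values are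
  -- equality in Cauchy-Schwarz.
  dichotomy : ∀ {e f} → IsEdge e → IsEdge f → Orthogonal e f ⊎ Parallel e f
  dichotomy {e} {z , w} Ee Ef = cases (sign-cases (edge-square Ee w)) (sign-cases (edge-square Ee z))
    where
    product : ∀ {p q} σ → p - q ≡ ℤ+ 2 * σ → s e w ≡ p → s e z ≡ q → ⟨ e , (z , w) ⟩ ≡ σ * ℤ+ n
    product σ p-q refl refl = ℤ.*-cancelˡ-≡ (ℤ+ 2) ⟨ e , (z , w) ⟩ (σ * ℤ+ n)
      (trans (inner-product e z w) (trans (cong (ℤ+ n *_) p-q) (lem (ℤ+ n) σ)))
      where
      lem : ∀ k σ → k * (ℤ+ 2 * σ) ≡ ℤ+ 2 * (σ * k)
      lem = solve-∀
    cases : s e w ≡ 1ℤ ⊎ s e w ≡ - 1ℤ → s e z ≡ 1ℤ ⊎ s e z ≡ - 1ℤ → _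
    cases (inj₁ p) (inj₁ q) = inj₁ (trans (product 0ℤ refl p q) (ℤ.*-zeroˡ (ℤ+ n)))
    cases (inj₂ p) (inj₂ q) = inj₁ (trans (product 0ℤ refl p q) (ℤ.*-zeroˡ (ℤ+ n)))
    cases (inj₁ p) (inj₂ q) = inj₂ (parallel-from-product Ee Ef 1ℤ refl (product 1ℤ refl p q))
    cases (inj₂ p) (inj₁ q) = inj₂ (parallel-from-product Ee Ef (- 1ℤ) refl (product (- 1ℤ) refl p q))

  -- By `inner-product`, two edges fail to be orthogonal exactly when they are in the
  -- Djoković-Winkler relation. One edge is kept from each class, and each class is to become one
  -- coordinate of the cube.
  edgeClasses : ∃ λ L → All IsEdge L × AllPairs Orthogonal L ×
    All (λ e → IsEdge e → Any (Parallel e) L) (cartesianProduct (allFin n) (allFin n))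
  edgeClasses = maximal (λ (x , y) → T? (adj G x y)) parallel-refl dichotomy (cartesianProduct (allFin n) (allFin n))

  L : List Pair
  L = proj₁ edgeClasses

  L-edges : All IsEdge L
  L-edges = proj₁ (proj₂ edgeClasses)

  L-maximal : ∀ {e} → IsEdge e → Any (Parallel e) L
  L-maximal {x , y} = All.lookup (proj₂ (proj₂ (proj₂ edgeClasses))) (∈-cartesianProduct⁺ (∈-allFin x) (∈-allFin y))

  -- Walking along an edge of the class of e leaves every other coordinate f unchanged: in
  -- `inner-product` the left side vanishes and n is nonzero.
  orthogonal⇒constant : ∀ {e f z w} → Parallel (z , w) e → Orthogonal f e → s f w - s f z ≡ 0ℤ
  orthogonal⇒constant {e} {f} {z} {w} (σ , _ , eq) f⊥e = ℤ.*-cancelˡ-≡ (ℤ+ n) (s f w - s f z) 0ℤ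
    (trans (sym (inner-product f z w)) (trans (cong (ℤ+ 2 *_) product) (sym (ℤ.*-zeroʳ (ℤ+ n)))))
    where
    lem : ∀ a σ c → a * (σ * c) ≡ σ * (a * c)
    lem = solve-∀
    product : ⟨ f , (z , w) ⟩ ≡ 0ℤ
    product = trans (∑-cong (λ u → trans (cong (s f u *_) (eq u)) (lem (s f u) σ (s e u))))
      (trans (*-distribˡ-∑ σ (λ u → s f u * s e u)) (trans (cong (σ *_) f⊥e) (ℤ.*-zeroʳ σ)))

  -- Only the representative e of the class of zw contributes. Its coordinate moves from -σ to σ,
  -- which gives 2σ · `s e u`.
  edge-expansion : ∀ {z w} (L : List Pair) → All IsEdge L → AllPairs Orthogonal L →
    T (adj G z w) → Any (Parallel (z , w)) L →
    ∀ u → ∑L (λ e → (s e w - s e z) * s e u) L ≡ ℤ+ 2 * s (z , w) u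
  edge-expansion {z} {w} (e ∷ L) (Ee ∷ EL) (e⊥L ∷ _) a (here ∥e@(σ , σ² , eq)) u = begin
    (s e w - s e z) * s e u + ∑L (λ e → (s e w - s e z) * s e u) L
      ≡⟨ cong ((s e w - s e z) * s e u +_) (∑L-zero (All.map vanish e⊥L)) ⟩
    (s e w - s e z) * s e u + 0ℤ
      ≡⟨ cong₂ (λ p q → (p - q) * s e u + 0ℤ) (flip w) (flip z) ⟩
    (σ * s (z , w) w - σ * s (z , w) z) * s e u + 0ℤ
      ≡⟨ cong₂ (λ p q → (σ * p - σ * q) * s e u + 0ℤ) (proj₂ (edge-ends a)) (proj₁ (edge-ends a)) ⟩
    (σ * 1ℤ - σ * - 1ℤ) * s e u + 0ℤ
      ≡⟨ lem σ (s e u) ⟩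
    ℤ+ 2 * (σ * s e u)
      ≡⟨ cong (ℤ+ 2 *_) (eq u) ⟨
    ℤ+ 2 * s (z , w) u ∎
    where
    open ≡-Reasoning
    lem : ∀ σ a → (σ * 1ℤ - σ * - 1ℤ) * a + 0ℤ ≡ ℤ+ 2 * (σ * a)
    lem = solve-∀
    flip : ∀ v → s e v ≡ σ * s (z , w) v
    flip v = sym (trans (cong (σ *_) (eq v)) (trans (sym (ℤ.*-assoc σ σ (s e v)))
      (trans (cong (_* s e v) σ²) (ℤ.*-identityˡ (s e v)))))
    vanish : ∀ {f} → Orthogonal e f → (s f w - s f z) * s f u ≡ 0ℤ
    vanish {f} e⊥f = trans
      (cong (_* s f u) (orthogonal⇒constant {e} {f} ∥e (trans (inner-comm f e) e⊥f))) (ℤ.*-zeroˡ (s f u))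
  edge-expansion {z} {w} (e ∷ L) (Ee ∷ EL) (e⊥L ∷ L⊥) a (there any) u = trans
    (cong₂ _+_ (trans (cong (_* s e u) (vanish e⊥L any)) (ℤ.*-zeroˡ (s e u))) (edge-expansion L EL L⊥ a any u))
    (ℤ.+-identityˡ (ℤ+ 2 * s (z , w) u))
    where
    vanish : ∀ {L} → All (Orthogonal e) L → Any (Parallel (z , w)) L → s e w - s e z ≡ 0ℤ
    vanish (e⊥f ∷ _) (here {f} ∥f) = orthogonal⇒constant {f} {e} ∥f e⊥f
    vanish (_ ∷ e⊥L) (there any)   = vanish e⊥L any

  -- Both sides telescope along a walk from z to w.
  expansion : ∀ z w u → ∑L (λ e → (s e w - s e z) * s e u) L ≡ ℤ+ 2 * s (z , w) u
  expansion z w u = along (proj₂ (connected z w))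
    where
    cancel : ∀ a c → (a - a) * c ≡ 0ℤ
    cancel = solve-∀
    cancel′ : ∀ a → ℤ+ 2 * (a - a) ≡ 0ℤ
    cancel′ = solve-∀
    split : ∀ a c e f → (e - a) * f ≡ (c - a) * f + (e - c) * f
    split = solve-∀
    join : ∀ a c e → ℤ+ 2 * (a - c) + ℤ+ 2 * (c - e) ≡ ℤ+ 2 * (a - e)
    join = solve-∀
    along : ∀ {z w k} → Walk G z w k → ∑L (λ e → (s e w - s e z) * s e u) L ≡ ℤ+ 2 * s (z , w) u
    along {z} here = trans (∑L-zero {L = L} (All.universal (λ e → cancel (s e z) (s e u)) L)) (sym (cancel′ (A z u)))
    along (step {z} {y} {w} a p) = begin
      ∑L (λ e → (s e w - s e z) * s e u) L
        ≡⟨ ∑L-cong {L = L} (All.universal (λ e → split (s e z) (s e y) (s e w) (s e u)) L) ⟩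
      ∑L (λ e → (s e y - s e z) * s e u + (s e w - s e y) * s e u) L
        ≡⟨ ∑L-+ (λ e → (s e y - s e z) * s e u) (λ e → (s e w - s e y) * s e u) L ⟩
      ∑L (λ e → (s e y - s e z) * s e u) L + ∑L (λ e → (s e w - s e y) * s e u) L
        ≡⟨ cong₂ _+_ (edge-expansion L L-edges (proj₁ (proj₂ (proj₂ edgeClasses))) a (L-maximal a) u) (along p) ⟩
      ℤ+ 2 * s (z , y) u + ℤ+ 2 * s (y , w) u
        ≡⟨ join (A z u) (A y u) (A w u) ⟩
      ℤ+ 2 * s (z , w) u ∎
      where open ≡-Reasoning

  -- Take the expansion at u = w minus that at u = z. A coordinate in which the signs differ
  -- contributes 4, so this is the Hamming distance in disguise.
  isometry : ∀ z w → ∑L (λ e → (s e w - s e z) * (s e w - s e z)) L ≡ ℤ+ 4 * A z w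
  isometry z w = begin
    ∑L (λ e → (s e w - s e z) * (s e w - s e z)) L
      ≡⟨ lem (∑L (λ e → (s e w - s e z) * (s e w - s e z)) L) (∑L (λ e → (s e w - s e z) * s e z) L) ⟩
    ∑L (λ e → (s e w - s e z) * (s e w - s e z)) L + ∑L (λ e → (s e w - s e z) * s e z) L -
      ∑L (λ e → (s e w - s e z) * s e z) L
      ≡⟨ cong (_- ∑L (λ e → (s e w - s e z) * s e z) L) (trans
           (sym (∑L-+ (λ e → (s e w - s e z) * (s e w - s e z)) (λ e → (s e w - s e z) * s e z) L))
           (∑L-cong {L = L} (All.universal (λ e → merge (s e w) (s e z)) L))) ⟩
    ∑L (λ e → (s e w - s e z) * s e w) L - ∑L (λ e → (s e w - s e z) * s e z) L
      ≡⟨ cong₂ _-_ (expansion z w w) (expansion z w z) ⟩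
    ℤ+ 2 * (A z w - A w w) - ℤ+ 2 * (A z z - A w z)
      ≡⟨ cong₂ (λ p q → ℤ+ 2 * (A z w - p) - ℤ+ 2 * (q - A w z)) (A-refl w) (A-refl z) ⟩
    ℤ+ 2 * (A z w - 0ℤ) - ℤ+ 2 * (0ℤ - A w z)
      ≡⟨ cong (λ p → ℤ+ 2 * (A z w - 0ℤ) - ℤ+ 2 * (0ℤ - p)) (A-sym w z) ⟩
    ℤ+ 2 * (A z w - 0ℤ) - ℤ+ 2 * (0ℤ - A z w)
      ≡⟨ double (A z w) ⟩
    ℤ+ 4 * A z w ∎
    where
    open ≡-Reasoning
    lem : ∀ p q → p ≡ p + q - q
    lem = solve-∀
    merge : ∀ a c → (a - c) * (a - c) + (a - c) * c ≡ (a - c) * a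
    merge = solve-∀
    double : ∀ a → ℤ+ 2 * (a - 0ℤ) - ℤ+ 2 * (0ℤ - a) ≡ ℤ+ 4 * a
    double = solve-∀

  rowSum : Fin n → ℤ
  rowSum x = sumFin (A x)

  -- A commutes with M, a polynomial in A, and M = bJ: compare the (x,y)-entries of AM and MA.
  rowSum-constant : b ≢ 0ℤ → ∀ x y → rowSum x ≡ rowSum y
  rowSum-constant b≢0 x y = ℤ.*-cancelˡ-≡ b (rowSum x) (rowSum y) ⦃ ℤ.≢-nonZero b≢0 ⦄ (begin
    b * rowSum x
      ≡⟨ trans (∑-cong (λ k → trans (cong (A x k *_) (constant k y)) (ℤ.*-comm (A x k) b))) (*-distribˡ-∑ b (A x)) ⟨
    (A ⊗ M) x y
      ≡⟨ ⊗-quad A A (ℤ+ 2 * ℤ+ n) x y ⟩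
    ℤ+ 4 * ((A ⊗ A) ⊗ A) x y + ℤ+ 2 * ℤ+ n * (A ⊗ A) x y
      ≡⟨ cong (_+ ℤ+ 2 * ℤ+ n * (A ⊗ A) x y) (*-distribˡ-∑ (ℤ+ 4) (λ k → (A ⊗ A) x k * A k y)) ⟨
    sumFin (λ k → ℤ+ 4 * ((A ⊗ A) x k * A k y)) + ℤ+ 2 * ℤ+ n * (A ⊗ A) x y
      ≡⟨ ∑-linear (ℤ+ 2 * ℤ+ n) (λ k → ℤ+ 4 * ((A ⊗ A) x k * A k y)) (λ k → A x k * A k y) ⟨
    sumFin (λ k → ℤ+ 4 * ((A ⊗ A) x k * A k y) + ℤ+ 2 * ℤ+ n * (A x k * A k y))
      ≡⟨ ∑-cong (λ k → trans (lem ((A ⊗ A) x k) (A k y) (ℤ+ n) (A x k)) (cong₂ _*_ (constant x k) (A-sym k y))) ⟩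
    sumFin (λ k → b * A y k)
      ≡⟨ *-distribˡ-∑ b (A y) ⟩
    b * rowSum y ∎)
    where
    open ≡-Reasoning
    lem : ∀ p a k c → ℤ+ 4 * (p * a) + ℤ+ 2 * k * (c * a) ≡ (ℤ+ 4 * p + ℤ+ 2 * k * c) * a
    lem = solve-∀

  edge-balanced : b ≢ 0ℤ → ∀ e → sumFin (s e) ≡ 0ℤ
  edge-balanced b≢0 (x , y) = trans (∑-cong (λ w → lem (A x w) (A y w))) (trans (∑-linear (- 1ℤ) (A x) (A y))
    (trans (sym (lem (rowSum x) (rowSum y))) (ℤ.i≡j⇒i-j≡0 (rowSum-constant b≢0 x y))))
    where
    lem : ∀ p q → p - q ≡ p + - 1ℤ * q
    lem = solve-∀

  -- Sum `isometry` over w. Each sign vector is balanced, hence differs from its value at z in half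
  -- of the places, and contributes 4 · n/2.
  rowSum-value : b ≢ 0ℤ → ∀ z → ℤ+ 4 * rowSum z ≡ ℤ+ length L * (ℤ+ n * ℤ+ 2)
  rowSum-value b≢0 z = begin
    ℤ+ 4 * rowSum z
      ≡⟨ *-distribˡ-∑ (ℤ+ 4) (A z) ⟨
    sumFin (λ w → ℤ+ 4 * A z w)
      ≡⟨ ∑-cong (λ w → isometry z w) ⟨
    sumFin (λ w → ∑L (λ e → (s e w - s e z) * (s e w - s e z)) L)
      ≡⟨ ∑-∑L (λ e w → (s e w - s e z) * (s e w - s e z)) L ⟩
    ∑L (λ e → sumFin (λ w → (s e w - s e z) * (s e w - s e z))) L
      ≡⟨ ∑L-cong (All.map (λ {e} → total {e}) L-edges) ⟩
    ∑L (λ _ → ℤ+ n * ℤ+ 2) L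
      ≡⟨ ∑L-const (ℤ+ n * ℤ+ 2) L ⟩
    ℤ+ length L * (ℤ+ n * ℤ+ 2) ∎
    where
    open ≡-Reasoning
    square : ∀ a c → (a - c) * (a - c) ≡ (a * a + c * c) + - ℤ+ 2 * c * a
    square = solve-∀
    total : ∀ {e} → IsEdge e → sumFin (λ w → (s e w - s e z) * (s e w - s e z)) ≡ ℤ+ n * ℤ+ 2
    total {e} Ee = begin
      sumFin (λ w → (s e w - s e z) * (s e w - s e z))
        ≡⟨ ∑-cong (λ w → trans (square (s e w) (s e z))
             (cong₂ (λ p q → p + q + - ℤ+ 2 * s e z * s e w) (edge-square Ee w) (edge-square Ee z))) ⟩
      sumFin (λ w → ℤ+ 2 + - ℤ+ 2 * s e z * s e w)
        ≡⟨ ∑-linear (- ℤ+ 2 * s e z) (λ _ → ℤ+ 2) (s e) ⟩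
      sumFin {n} (λ _ → ℤ+ 2) + - ℤ+ 2 * s e z * sumFin (s e)
        ≡⟨ cong₂ (λ p q → p + - ℤ+ 2 * s e z * q) (∑-const {n} (ℤ+ 2)) (edge-balanced b≢0 e) ⟩
      ℤ+ n * ℤ+ 2 + - ℤ+ 2 * s e z * 0ℤ
        ≡⟨ cong (ℤ+ n * ℤ+ 2 +_) (ℤ.*-zeroʳ (- ℤ+ 2 * s e z)) ⟩
      ℤ+ n * ℤ+ 2 + 0ℤ
        ≡⟨ ℤ.+-identityʳ (ℤ+ n * ℤ+ 2) ⟩
      ℤ+ n * ℤ+ 2 ∎

  -- M = bJ applied to the all-ones vector, which is an eigenvector of A because the row sums agree.
  rowSum-quadratic : b ≢ 0ℤ → ∀ z → ℤ+ 4 * (rowSum z * rowSum z) + ℤ+ 2 * ℤ+ n * rowSum z ≡ ℤ+ n * b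
  rowSum-quadratic b≢0 z = begin
    ℤ+ 4 * (rowSum z * rowSum z) + ℤ+ 2 * ℤ+ n * rowSum z
      ≡⟨ cong (λ p → ℤ+ 4 * p + ℤ+ 2 * ℤ+ n * rowSum z) (*-distribʳ-∑ (rowSum z) (A z)) ⟨
    ℤ+ 4 * sumFin (λ k → A z k * rowSum z) + ℤ+ 2 * ℤ+ n * rowSum z
      ≡⟨ cong (λ p → ℤ+ 4 * p + ℤ+ 2 * ℤ+ n * rowSum z) (∑-cong (λ k →
           trans (cong (A z k *_) (rowSum-constant b≢0 z k)) (sym (*-distribˡ-∑ (A z k) (A k))))) ⟩
    ℤ+ 4 * sumFin (λ k → sumFin (λ y → A z k * A k y)) + ℤ+ 2 * ℤ+ n * rowSum z
      ≡⟨ cong (λ p → ℤ+ 4 * p + ℤ+ 2 * ℤ+ n * rowSum z) (∑-comm (λ k y → A z k * A k y)) ⟩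
    ℤ+ 4 * sumFin ((A ⊗ A) z) + ℤ+ 2 * ℤ+ n * rowSum z
      ≡⟨ cong (_+ ℤ+ 2 * ℤ+ n * rowSum z) (*-distribˡ-∑ (ℤ+ 4) ((A ⊗ A) z)) ⟨
    sumFin (λ y → ℤ+ 4 * (A ⊗ A) z y) + ℤ+ 2 * ℤ+ n * rowSum z
      ≡⟨ ∑-linear (ℤ+ 2 * ℤ+ n) (λ y → ℤ+ 4 * (A ⊗ A) z y) (A z) ⟨
    sumFin (M z)
      ≡⟨ trans (∑-cong (constant z)) (∑-const {n} b) ⟩
    ℤ+ n * b ∎
    where open ≡-Reasoning

  -- Substitute the row sum μn/2 into its quadratic equation. The factor 4n makes the row sum enter
  -- as 4 · `rowSum o`, so no halves arise.
  classes-quadratic : b ≢ 0ℤ → ℤ+ n * (ℤ+ length L * ℤ+ suc (length L)) ≡ b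
  classes-quadratic b≢0 = ℤ.*-cancelˡ-≡ (ℤ+ n) (ℤ+ n * (μ * (1ℤ + μ))) b
    (ℤ.*-cancelˡ-≡ (ℤ+ 4) (ℤ+ n * (ℤ+ n * (μ * (1ℤ + μ)))) (ℤ+ n * b) (begin
      ℤ+ 4 * (ℤ+ n * (ℤ+ n * (μ * (1ℤ + μ))))
        ≡⟨ before μ (ℤ+ n) ⟩
      (μ * (ℤ+ n * ℤ+ 2)) * (μ * (ℤ+ n * ℤ+ 2)) + ℤ+ 2 * ℤ+ n * (μ * (ℤ+ n * ℤ+ 2))
        ≡⟨ cong (λ q → q * q + ℤ+ 2 * ℤ+ n * q) (rowSum-value b≢0 o) ⟨
      (ℤ+ 4 * rowSum o) * (ℤ+ 4 * rowSum o) + ℤ+ 2 * ℤ+ n * (ℤ+ 4 * rowSum o)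
        ≡⟨ after (rowSum o) (ℤ+ n) ⟩
      ℤ+ 4 * (ℤ+ 4 * (rowSum o * rowSum o) + ℤ+ 2 * ℤ+ n * rowSum o)
        ≡⟨ cong (ℤ+ 4 *_) (rowSum-quadratic b≢0 o) ⟩
      ℤ+ 4 * (ℤ+ n * b) ∎))
    where
    open ≡-Reasoning
    μ : ℤ
    μ = ℤ+ length L
    o : Fin n
    o = Fin.fromℕ< 0<n
    before : ∀ m k → ℤ+ 4 * (k * (k * (m * (1ℤ + m)))) ≡
      (m * (k * ℤ+ 2)) * (m * (k * ℤ+ 2)) + ℤ+ 2 * k * (m * (k * ℤ+ 2))
    before = solve-∀
    after : ∀ r k → (ℤ+ 4 * r) * (ℤ+ 4 * r) + ℤ+ 2 * k * (ℤ+ 4 * r) ≡ ℤ+ 4 * (ℤ+ 4 * (r * r) + ℤ+ 2 * k * r)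
    after = solve-∀

  positive : ℤ → Bool
  positive (ℤ+ _)     = true
  positive ℤ.-[1+ _ ] = false

  word : (L : List Pair) → Fin n → Vec Bool (length L)
  word []      z = []
  word (e ∷ L) z = positive (s e z) ∷ word L z

  word-ham : (L : List Pair) → All IsEdge L → ∀ z w →
    ℤ+ 4 * ℤ+ ham (word L z) (word L w) ≡ ∑L (λ e → (s e w - s e z) * (s e w - s e z)) L
  word-ham []      []        z w = refl
  word-ham (e ∷ L) (Ee ∷ EL) z w = trans
    (ℤ.*-distribˡ-+ (ℤ+ 4) (ℤ+ b2n (positive (s e z) xor positive (s e w))) (ℤ+ ham (word L z) (word L w)))
    (cong₂ _+_ (head {s e z} {s e w} (sign-cases (edge-square Ee z)) (sign-cases (edge-square Ee w)))
      (word-ham L EL z w))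
    where
    head : ∀ {p q} → p ≡ 1ℤ ⊎ p ≡ - 1ℤ → q ≡ 1ℤ ⊎ q ≡ - 1ℤ →
      ℤ+ 4 * ℤ+ b2n (positive p xor positive q) ≡ (q - p) * (q - p)
    head (inj₁ refl) (inj₁ refl) = refl
    head (inj₁ refl) (inj₂ refl) = refl
    head (inj₂ refl) (inj₁ refl) = refl
    head (inj₂ refl) (inj₂ refl) = refl

  word-isometry : ∀ z w → ham (word L z) (word L w) ≡ D z w
  word-isometry z w = ℤ.+-injective (ℤ.*-cancelˡ-≡ (ℤ+ 4) (ℤ+ ham (word L z) (word L w)) (A z w)
    (trans (word-ham L L-edges z w) (isometry z w)))

  length-L : ∀ d → b ≢ 0ℤ → b ≡ ℤ+ d * ℤ+ suc d * ℤ+ n → length L ≡ d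
  length-L d b≢0 b≡ = pronic-injective (ℤ.+-injective (trans (ℤ.pos-* (length L) (suc (length L)))
    (trans (ℤ.*-cancelˡ-≡ (ℤ+ n) (ℤ+ length L * ℤ+ suc (length L)) (ℤ+ d * ℤ+ suc d)
      (trans (classes-quadratic b≢0) (trans b≡ (ℤ.*-comm (ℤ+ d * ℤ+ suc d) (ℤ+ n)))))
      (sym (ℤ.pos-* d (suc d))))))
    where
    pronic-injective : ∀ {m d} → m ℕ.* suc m ≡ d ℕ.* suc d → m ≡ d
    pronic-injective {m} {d} eq with ℕ.<-cmp m d
    ... | tri≈ _ m≡d _ = m≡d
    ... | tri< m<d _ _ = contradiction eq (ℕ.<⇒≢ (ℕ.*-mono-< m<d (ℕ.s<s m<d)))
    ... | tri> _ _ d<m = contradiction (sym eq) (ℕ.<⇒≢ (ℕ.*-mono-< d<m (ℕ.s<s d<m)))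

  cube-embedding : ∀ d → b ≢ 0ℤ → b ≡ ℤ+ d * ℤ+ suc d * ℤ+ n →
    ∃ λ (φ : Fin n → Vec Bool d) → ∀ z w → ham (φ z) (φ w) ≡ D z w
  cube-embedding d b≢0 b≡ =
    subst (λ k → ∃ λ (φ : Fin n → Vec Bool k) → ∀ z w → ham (φ z) (φ w) ≡ D z w)
      (length-L d b≢0 b≡) (word L , word-isometry)

-- From the embedding to the isomorphism

injective⇒surjective : (f : Fin n → Fin n) → (∀ {x y} → f x ≡ f y → x ≡ y) → ∀ y → ∃ λ x → f x ≡ y
injective⇒surjective {suc n} f inj y with Fin.any? (λ x → f x Fin.≟ y)
... | yes preimage = preimage
-- Deleting the missed value y from the codomain would leave an injection into a set with one
-- element fewer.
... | no ¬preimage = contradiction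
  (Fin.injective⇒≤ {f = λ x → punchOut (missed x)}
    (λ {x} {x′} eq → inj (Fin.punchOut-injective (missed x) (missed x′) eq)))
  ℕ.1+n≰n
  where
  missed : ∀ x → y ≢ f x
  missed x eq = ¬preimage (x , sym eq)

charMatrix≡char : (D : Fin n → Fin n → ℕ) (t : ℤ) → ∀ i j → charMatrix t D i j ≡ char (distanceMatrix D) t i j
charMatrix≡char D t i j with i Fin.≟ j
... | yes refl = cong (_- ℤ+ D i i) (sym (trans (cong (t *_) (δ-refl i)) (ℤ.*-identityʳ t)))
... | no i≢j   = sym (trans (cong (λ x → t * x - ℤ+ D i j) (δ-≢ i≢j))
  (trans (cong (_- ℤ+ D i j) (ℤ.*-zeroʳ t)) (ℤ.+-identityˡ (- ℤ+ D i j))))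

theorem5p4 : (d : ℕ) → d ≥ 1 →
    ∀ {n : ℕ} (Γ : Graph n) → Connected Γ →
    (D : Fin n → Fin n → ℕ) → IsDistanceMatrix Γ D →
    (DQ : Fin (2 ^ d) → Fin (2 ^ d) → ℕ) → IsDistanceMatrix (Cube d) DQ →
    Cospectral D DQ →
    Γ ≅ Cube d
theorem5p4 d@(suc _) d≥1 {n} Γ connected D isD DQ isDQ cospectral = main n≡2^d Γ connected D isD charPoly≡
  where
  charPoly≡ : ∀ t → charPoly (distanceMatrix D) t ≡ charPoly (distanceMatrix DQ) t
  charPoly≡ t = trans (sym (det-cong (charMatrix≡char D t))) (trans (cospectral t) (det-cong (charMatrix≡char DQ t)))

  n≡2^d : n ≡ 2 ^ d
  n≡2^d = charPoly-size (distanceMatrix D) (distanceMatrix DQ) charPoly≡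

  N b : ℤ
  N = 2^ d
  b = ℤ+ d * ℤ+ suc d * N

  instance
    N≢0 : ℤ.NonZero N
    N≢0 = ℤ.≢-nonZero (λ eq → ℕ.<⇒≢ (ℕ.m^n>0 2 d) (sym (ℤ.+-injective eq)))

  -- Here d ≥ 1 enters: the equality of row sums is obtained by cancelling b.
  b≢0 : b ≢ 0ℤ
  b≢0 b≡0 with ℤ.i*j≡0⇒i≡0∨j≡0 (ℤ+ d * ℤ+ suc d) b≡0
  ... | inj₁ ()
  ... | inj₂ N≡0 = ℕ.<⇒≢ (ℕ.m^n>0 2 d) (sym (ℤ.+-injective N≡0))

  -- The order is quantified afresh so that the equation can be matched with `refl`, putting Γ and
  -- the cube on the same vertex type.
  main : ∀ {n} → n ≡ 2 ^ d → (Γ : Graph n) → Connected Γ → (D : Fin n → Fin n → ℕ) → IsDistanceMatrix Γ D →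
    (∀ t → charPoly (distanceMatrix D) t ≡ charPoly (distanceMatrix DQ) t) → Γ ≅ Cube d
  main refl Γ connected D isD charPoly≡ = mk↔ₛ′ f (proj₁ ∘ f-surjective) (proj₂ ∘ f-surjective)
      (λ x → f-injective (proj₂ (f-surjective (f x)))) , adj-preserved
    where
    M Q : Matrix (2 ^ d)
    M = quad (ℤ+ 2 * N) (distanceMatrix D)
    Q = quad (ℤ+ 2 * N) (distanceMatrix DQ)

    Q≡b : ∀ x y → Q x y ≡ b
    Q≡b = cube-quad {d} isDQ

    rank1 : ∀ x y → M x x * M y y ≡ M x y * M x y
    rank1 = rankOne M (M-sym Γ isD) (trans
      (cong₂ _*_ tr² tr²) (trans (constant-trace Q b Q≡b) (sym (tr-quad⁴ A B charPoly≡ c))))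
      where
      A B : Matrix (2 ^ d)
      A = distanceMatrix D
      B = distanceMatrix DQ
      c : ℤ
      c = ℤ+ 2 * N
      tr² : tr (M ⊗ M) ≡ tr (Q ⊗ Q)
      tr² = tr-quad² A B charPoly≡ c

    M≡b : ∀ x y → M x y ≡ b
    M≡b x y = ℤ.*-cancelˡ-≡ N (M x y) b (begin
      N * M x y              ≡⟨ ∑-const {2 ^ d} (M x y) ⟨
      -- Constancy along row x, symmetry, and constancy along row i carry the entry to the diagonal
      -- position i.
      sumFin {2 ^ d} (λ _ → M x y)   ≡⟨ ∑-cong (λ i → trans (rank1⇒constant Γ isD connected rank1 x y)
                                 (trans (sym (rank1⇒constant Γ isD connected rank1 x i))
                                   (trans (M-sym Γ isD x i) (rank1⇒constant Γ isD connected rank1 i x)))) ⟩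
      tr M                   ≡⟨ tr-quad (distanceMatrix D) (distanceMatrix DQ) charPoly≡ (ℤ+ 2 * N) ⟩
      tr Q                   ≡⟨ ∑-cong (λ i → Q≡b i i) ⟩
      sumFin {2 ^ d} (λ _ → b)       ≡⟨ ∑-const {2 ^ d} b ⟩
      N * b                  ∎)
      where open ≡-Reasoning

    embedding : ∃ λ (φ : Fin (2 ^ d) → Vec Bool d) → ∀ z w → ham (φ z) (φ w) ≡ D z w
    embedding = Embedding.cube-embedding Γ isD connected (ℕ.m^n>0 2 d) b M≡b d b≢0 refl

    φ : Fin (2 ^ d) → Vec Bool d
    φ = proj₁ embedding

    f : Fin (2 ^ d) → Fin (2 ^ d)
    f x = enc (φ x)

    f-injective : ∀ {x y} → f x ≡ f y → x ≡ y
    f-injective {x} {y} eq = Distance.D≡0⇒≡ Γ isD x y (trans (sym (proj₂ embedding x y))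
      (trans (cong (λ v → ham v (φ y)) (enc-injective (φ x) (φ y) eq)) (ham-refl (φ y))))

    f-surjective : ∀ y → ∃ λ x → f x ≡ y
    f-surjective = injective⇒surjective f f-injective

    adj-preserved : ∀ x y → adj Γ x y ≡ adj (Cube d) (f x) (f y)
    adj-preserved x y = trans (Distance.adj≡ Γ isD x y)
      (cong (_≡ᵇ 1) (trans (sym (proj₂ embedding x y)) (sym (hamming-enc (φ x) (φ y)))))
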